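{- Let $n\ge 1$ and let $G$ be a connected graph on $n$ vertices. Let $K_n$ be the complete graph on $n$ vertices. Then $G\geq_s K_n$ if and only if $X_G$ is Schur-positive.
   Context: All graphs are finite and simple. The chromatic symmetric function of a graph $G$ with vertices $v_1,\dots,v_n$ is $X_G=\sum_{\kappa}x_{\kappa(v_1)}\cdots x_{\kappa(v_n)}$, summed over all proper colorings $\kappa:V(G)\to\{1,2,3,\dots\}$ (adjacent vertices get different colors); it is a homogeneous symmetric function of degree $n$ in commuting variables $x_1,x_2,\dots$ over $\mathbb{Q}$. Let $s_\lambda$ denote the Schur symmetric function of the partition $\lambda$ (so $s_{(1^n)}=e_n$, the $n$-th elementary symmetric function); $\{s_\lambda:\lambda\vdash n\}$ is a basis of the degree-$n$ symmetric functions. $[s_\lambda]F$ denotes the coefficient of $s_\lambda$ in $F$, and $F$ is Schur-positive if $[s_\lambda]F\ge 0$ for all $\lambda$. For connected graphs $G,H$ on $n$ vertices (for which $[s_{(1^n)}]X_G$ and $[s_{(1^n)}]X_H$ are positive), set $$X_s(G,H)=X_G-\frac{[s_{(1^n)}]X_G}{[s_{(1^n)}]X_H}X_H,$$ and write $G\geq_s H$ if $X_s(G,H)$ is Schur-positive. -}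

module Defs where

open import Level using (0ℓ)
open import Data.Nat as ℕ using (ℕ; zero; suc)
import Data.Nat.Properties as ℕ
open import Data.Nat.ListAction using (sum)
open import Data.Integer using (+_)
open import Data.Rational using (ℚ; 0ℚ; _+_; _*_; _-_; _≤_; _/_; _÷_; NonZero)
open import Data.Fin as Fin using (Fin; finToFun)
import Data.Fin.Properties as Fin
open import Data.List as List
  using (List; []; _∷_; length; map; filter; concat; concatMap; foldr; replicate;
         cartesianProductWith; allFin; upTo)
open import Data.List.Relation.Unary.All as All using (All)
open import Data.List.Relation.Unary.Linked as Linked using (Linked)
open import Data.List.Relation.Binary.Prefix.Heterogeneous using (Prefix)
open import Data.List.Relation.Binary.Prefix.Heterogeneous.Properties using (prefix?)
open import Data.Vec as Vec using (Vec)
import Data.Vec.Properties as Vec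
open import Data.Product using (Σ-syntax; _×_)
open import Function using (flip)
open import Relation.Binary using (Rel; Symmetric; Irreflexive; Decidable)
open import Relation.Binary.PropositionalEquality using (_≡_; _≢_; refl; ≢-sym)
open import Relation.Binary.Construct.Closure.ReflexiveTransitive using (Star)
open import Relation.Nullary using (Dec)
open import Relation.Nullary.Decidable using (¬?; _×-dec_; _→-dec_)

------------------------------------------------------------------------
-- Graphs

record Graph (n : ℕ) : Set₁ where
  infix 4 _~_ _~?_
  field
    _~_      : Rel (Fin n) 0ℓ
    ~-sym    : Symmetric _~_
    ~-irrefl : Irreflexive _≡_ _~_
    _~?_     : Decidable _~_

-- Any two vertices are joined by a walk.  (The empty graph satisfies this
-- vacuously, so nonemptiness has to be asked for separately.)

Connected : ∀ {n} → Graph n → Set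
Connected G = ∀ u v → Star (Graph._~_ G) u v

complete : ∀ n → Graph n
complete n = record
  { _~_      = _≢_
  ; ~-sym    = ≢-sym
  ; ~-irrefl = λ u≡v u≢v → u≢v u≡v
  ; _~?_     = λ u v → ¬? (u Fin.≟ v)
  }

------------------------------------------------------------------------
-- Formal power series over ℚ in the variables x₁, x₂, …

-- F (α₁ ∷ … ∷ αₖ ∷ []) is the coefficient of x₁^α₁ ⋯ xₖ^αₖ in F.  A monomial
-- is named by several vectors, which differ by trailing zeros; both families
-- of series constructed below take the same value on all of them.

Series : Set
Series = ∀ {k} → Vec ℕ k → ℚ

infix 4 _≈_
_≈_ : Series → Series → Set
F ≈ H = ∀ {k} (α : Vec ℕ k) → F α ≡ H α

infixl 6 _⊖_
_⊖_ : Series → Series → Series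
(F ⊖ H) α = F α - H α

infixr 7 _·_
_·_ : ℚ → Series → Series
(c · F) α = c * F α

fromℕ : ℕ → ℚ
fromℕ m = + m / 1

-- The exponent vector of the monomial ∏ x_i, i running over the word w.

content : ∀ {k} → List (Fin k) → Vec ℕ k
content w = Vec.tabulate λ i → length (filter (i Fin.≟_) w)

_≟ᵉ_ : ∀ {k} (α β : Vec ℕ k) → Dec (α ≡ β)
_≟ᵉ_ = Vec.≡-dec ℕ._≟_

------------------------------------------------------------------------
-- The chromatic symmetric function

Proper : ∀ {n k} → Graph n → (Fin n → Fin k) → Set
Proper G κ = ∀ u v → u ~ v → κ u ≢ κ v
  where open Graph G

proper? : ∀ {n k} (G : Graph n) (κ : Fin n → Fin k) → Dec (Proper G κ)
proper? G κ = Fin.all? λ u → Fin.all? λ v → (u ~? v) →-dec ¬? (κ u Fin.≟ κ v)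
  where open Graph G

colorings : ∀ n k → List (Fin n → Fin k)
colorings n k = map finToFun (allFin (k ℕ.^ n))

-- The colorings contributing to x₁^α₁ ⋯ xₖ^αₖ only use the first k colors,
-- so it suffices to count proper colorings κ : V(G) → Fin k.

X : ∀ {n} → Graph n → Series
X {n} G {k} α = fromℕ (length (filter contributes? (colorings n k)))
  where
  contributes? : (κ : Fin n → Fin k) → Dec (Proper G κ × content (List.tabulate κ) ≡ α)
  contributes? κ = proper? G κ ×-dec (content (List.tabulate κ) ≟ᵉ α)

------------------------------------------------------------------------
-- Partitions

infix 4 _⊢_ _⊢?_
_⊢_ : List ℕ → ℕ → Set
μ ⊢ n = Linked ℕ._≥_ μ × All (0 ℕ.<_) μ × sum μ ≡ n

_⊢?_ : ∀ μ n → Dec (μ ⊢ n)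
μ ⊢? n = Linked.linked? (flip ℕ._≤?_) μ ×-dec All.all? (0 ℕ.<?_) μ ×-dec (sum μ ℕ.≟ n)

choices : {A : Set} → List (List A) → List (List A)
choices []         = [] ∷ []
choices (xs ∷ xss) = cartesianProductWith _∷_ xs (choices xss)

words : {A : Set} → List A → ℕ → List (List A)
words xs m = choices (replicate m xs)

-- A partition of n has at most n parts, each of them at most n.

partitions : ℕ → List (List ℕ)
partitions n = filter (_⊢? n) (concatMap (words (upTo (suc n))) (upTo (suc n)))

------------------------------------------------------------------------
-- Schur functions

-- Tableaux are lists of rows in English notation.  In the column condition
-- the lower row must be entrywise greater than the part of the upper row
-- directly above it.

Semistandard : ∀ {k} → List (List (Fin k)) → Set
Semistandard T =
  All (Linked Fin._≤_) T × Linked (λ upper lower → Prefix Fin._>_ lower upper) T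

semistandard? : ∀ {k} (T : List (List (Fin k))) → Dec (Semistandard T)
semistandard? T =
  All.all? (Linked.linked? Fin._≤?_) T
    ×-dec Linked.linked? (λ upper lower → prefix? (flip Fin._<?_) lower upper) T

fillings : ∀ k → List ℕ → List (List (List (Fin k)))
fillings k μ = choices (map (words (allFin k)) μ)

-- The Schur function of μ as the generating function of semistandard Young
-- tableaux of shape μ; its coefficient at α is the Kostka number K_{μ,α}.

s : List ℕ → Series
s μ {k} α = fromℕ (length (filter contributes? (fillings k μ)))
  where
  contributes? : (T : List (List (Fin k))) → Dec (Semistandard T × content (concat T) ≡ α)
  contributes? T = semistandard? T ×-dec (content (concat T) ≟ᵉ α)

∑s : ℕ → (List ℕ → ℚ) → Series
∑s n c α = foldr _+_ 0ℚ (map (λ μ → c μ * s μ α) (partitions n))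

-- F = Σ_{μ ⊢ n} coeff μ · s_μ.  As the s_μ form a basis, every homogeneous
-- symmetric function F of degree n has such an expansion, and coeff μ is
-- determined for all μ ⊢ n: it is [s_μ]F.  (Values of coeff at lists that are
-- not partitions of n play no role.)

record SchurExpansion (n : ℕ) (F : Series) : Set where
  field
    coeff   : List ℕ → ℚ
    expands : F ≈ ∑s n coeff

open SchurExpansion public

SchurPositive : ℕ → Series → Set
SchurPositive n F = Σ[ E ∈ SchurExpansion n F ] (∀ μ → μ ⊢ n → 0ℚ ≤ coeff E μ)

------------------------------------------------------------------------
-- The relation G ≥ₛ H

1^ : ℕ → List ℕ
1^ n = replicate n 1

Xₛ : ∀ {n} (G H : Graph n)
     (EG : SchurExpansion n (X G)) (EH : SchurExpansion n (X H)) →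
     .{{NonZero (coeff EH (1^ n))}} → Series
Xₛ {n} G H EG EH = X G ⊖ (coeff EG (1^ n) ÷ coeff EH (1^ n)) · X H

-- The NonZero component is what makes the quotient meaningful; it holds
-- whenever H is connected.

infix 4 _≥ₛ_
_≥ₛ_ : ∀ {n} → Graph n → Graph n → Set
_≥ₛ_ {n} G H =
  Σ[ EG ∈ SchurExpansion n (X G) ]
  Σ[ EH ∈ SchurExpansion n (X H) ]
  Σ[ nz ∈ NonZero (coeff EH (1^ n)) ]
    SchurPositive n (Xₛ G H EG EH {{nz}})

{-# OPTIONS --safe #-}
module Submission where

-- Pairing with eₙ, F ↦ Σ_α (-1)^(n-ℓ(α)) [x^α]F over the compositions α of n, is a linear functional
-- that vanishes on s_μ for every μ ⊢ n other than 1ⁿ and is positive on s_{1ⁿ}; so it reads off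
-- [s_{1ⁿ}], up to a positive factor.  On s_μ it is a signed count of the semistandard tableaux
-- whose entries are exactly 1, …, m for some m, and a sign-reversing involution cancels them as soon as
-- the first row has two cells.  On X_G it is the signed count of the surjective proper colorings,
-- (-1)ⁿ times the chromatic polynomial at -1, which is nonnegative by deletion-contraction.
-- Hence [s_{1ⁿ}]X_G ≥ 0.  Since X_{K_n} is a positive multiple of s_{1ⁿ}, passing between X_G and
-- X_s(G, K_n) changes no other Schur coefficient, and the one at 1ⁿ is nonnegative on both sides.

open import Defs
open import Level using (Level; _⊔_)
open import Data.Bool using (true; false; if_then_else_)
open import Data.Nat as ℕ using (ℕ; zero; suc; pred; z≤n; s≤s; _≥_)
import Data.Nat.Properties as ℕ
open import Data.Nat.ListAction using (sum)
import Data.Integer as ℤ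
import Data.Integer.Properties as ℤ
open import Data.Rational as ℚ using (ℚ; 0ℚ; 1ℚ; _+_; _*_; _-_; -_; _≤_; _÷_; 1/_)
import Data.Rational.Properties as ℚ
import Data.Rational.Unnormalised as ℚᵘ
import Data.Rational.Unnormalised.Properties as ℚᵘ
open import Data.Rational.Solver using (module +-*-Solver)
open import Data.Fin as Fin using (Fin; zero; suc; toℕ; fromℕ<; finToFun; funToFin; punchIn; punchOut)
import Data.Fin.Properties as Fin
open import Data.Vec as Vec using (Vec; []; _∷_; lookup)
import Data.Vec.Properties as Vec
open import Data.List as List
  using (List; []; _∷_; _++_; length; map; filter; foldr; drop; concat; concatMap;
         cartesianProduct; cartesianProductWith; allFin; upTo)
import Data.List.Properties as List
open import Data.List.Relation.Unary.Any as Any using (Any; here; there)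
import Data.List.Relation.Unary.Any.Properties as Any
open import Data.List.Relation.Unary.All as All using (All; []; _∷_)
import Data.List.Relation.Unary.All.Properties as All
open import Data.List.Relation.Unary.AllPairs as AllPairs using (AllPairs; []; _∷_)
import Data.List.Relation.Unary.AllPairs.Properties as AllPairs
open import Data.List.Relation.Unary.Linked as Linked using (Linked; []; [-]; _∷_)
import Data.List.Relation.Unary.Linked.Properties as Linked
open import Data.List.Relation.Unary.Unique.Propositional using (Unique)
import Data.List.Relation.Unary.Unique.Propositional.Properties as Unique
open import Data.List.Relation.Binary.Disjoint.Propositional using (Disjoint)
open import Data.List.Relation.Binary.Pointwise using (Pointwise; []; _∷_)
open import Data.List.Relation.Binary.Prefix.Heterogeneous using (Prefix; []; _∷_)
import Data.List.Relation.Binary.Prefix.Heterogeneous.Properties as Prefix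
open import Data.List.Membership.Propositional using (_∈_)
open import Data.List.Membership.Propositional.Properties
import Data.List.Membership.DecPropositional as DecMembership
open import Data.Product using (∃; ∃₂; _×_; _,_; proj₁; proj₂)
open import Data.Sum using (_⊎_; inj₁; inj₂)
open import Data.Unit using (⊤; tt)
open import Data.Empty using (⊥; ⊥-elim)
open import Function using (_∘_; id)
open import Function.Bundles using (_⇔_; mk⇔)
open import Relation.Nullary using (¬_; Dec; yes; no; does; contradiction)
open import Relation.Nullary.Decidable using (_×-dec_; ¬?; dec-true; dec-false)
open import Relation.Unary using (Decidable; U)
open import Relation.Unary.Properties using (U?)
open import Relation.Binary using (DecidableEquality)
open import Relation.Binary.PropositionalEquality

-- The quotient in `Xₛ` is formed from whichever Schur expansions of X_G and X_{K_n} are supplied,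
-- so its sign has to be settled for every expansion at once. This is why the argument goes through
-- a linear functional on series: applied to both sides of `expands`, it isolates the coefficient at
-- 1ⁿ whatever the other coefficients are. The chromatic polynomial χ enters because a proper
-- coloring with q available colors is surjective onto the set of colors that it uses: χ(q) is the
-- sum over k of C(q,k) times the number of proper colorings onto k colors, and C(-1,k) = (-1)^k.
-- The signed counts stand in for the polynomial throughout. Deletion-contraction holds for each k
-- separately; contraction lowers the number of vertices by one, which flips the sign and turns the
-- difference into a sum of nonnegative terms. By Stanley's theorem the resulting number is that of
-- the acyclic orientations.

private
  variable
    ℓa ℓb ℓp ℓq ℓr : Level
    A : Set ℓa
    B : Set ℓb

-- Counting

length-⊆ : {xs ys : List A} → Unique xs → (∀ {x} → x ∈ xs → x ∈ ys) → length xs ℕ.≤ length ys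
length-⊆ {xs = []} [] xs⊆ys = z≤n
length-⊆ {xs = x ∷ xs} (x∉xs ∷ xs!) xs⊆ys with as , bs , refl ← ∈-∃++ (xs⊆ys (here refl)) =
  subst (suc (length xs) ℕ.≤_) (sym (List.length-++-sucʳ as x bs)) (s≤s (length-⊆ xs! tail⊆))
  where
  tail⊆ : ∀ {y} → y ∈ xs → y ∈ as ++ bs
  tail⊆ y∈xs with ∈-++⁻ as (xs⊆ys (there y∈xs))
  ... | inj₁ y∈as          = ∈-++⁺ˡ y∈as
  ... | inj₂ (here refl)   = ⊥-elim (All.All¬⇒¬Any x∉xs y∈xs)
  ... | inj₂ (there y∈bs)  = ∈-++⁺ʳ as y∈bs

map-unique⁺ : {P : A → Set ℓp} {f : A → B} → (∀ {x y} → P x → P y → f x ≡ f y → x ≡ y) →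
  ∀ {xs} → All P xs → Unique xs → Unique (map f xs)
map-unique⁺ inj []         []           = []
map-unique⁺ inj (px ∷ pxs) (x∉xs ∷ xs!) =
  All.map⁺ (All.zipWith (λ (py , x≢y) fx≡fy → x≢y (inj px py fx≡fy)) (pxs , x∉xs)) ∷ map-unique⁺ inj pxs xs!

-- The counts to be compared are lengths of filtered lists over different types: coloring functions,
-- vectors, fillings over `Fin k`, fillings over `ℕ`. A duplicate-free enumeration makes them
-- comparable, because its length depends on `P` alone (`card-unique`) and bijections transport it
-- (`card-map`). `P` stays a predicate on `A`, so two proofs of `P x` never count as two elements.
record Card {A : Set ℓa} (P : A → Set ℓp) (n : ℕ) : Set (ℓa ⊔ ℓp) where
  field
    elements : List A
    unique   : Unique elements
    sound    : ∀ {x} → x ∈ elements → P x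
    exhaustive : ∀ {x} → P x → x ∈ elements
    size     : length elements ≡ n

open Card public

card-↣ : {P : A → Set ℓp} {Q : B → Set ℓq} {m n : ℕ} → Card P m → Card Q n →
  (f : A → B) → (∀ {x} → P x → Q (f x)) → (∀ {x y} → P x → P y → f x ≡ f y → x ≡ y) → m ℕ.≤ n
card-↣ P# Q# f P⇒Q inj = subst₂ ℕ._≤_ (trans (List.length-map f (elements P#)) (size P#)) (size Q#)
  (length-⊆ (map-unique⁺ inj (All.tabulate (sound P#)) (unique P#)) image⊆)
  where
  image⊆ : ∀ {y} → y ∈ map f (elements P#) → y ∈ elements Q#
  image⊆ y∈ with x , x∈ , refl ← ∈-map⁻ f y∈ = exhaustive Q# (P⇒Q (sound P# x∈))

card-unique : {P : A → Set ℓp} {m n : ℕ} → Card P m → Card P n → m ≡ n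
card-unique P# P#′ = ℕ.≤-antisym (card-↣ P# P#′ id id (λ _ _ → id)) (card-↣ P#′ P# id id (λ _ _ → id))

card-map : {P : A → Set ℓp} {Q : B → Set ℓq} {n : ℕ} → Card P n → (f : A → B) →
  (∀ {x} → P x → Q (f x)) → (∀ {x y} → P x → P y → f x ≡ f y → x ≡ y) →
  (∀ {y} → Q y → ∃ λ x → P x × f x ≡ y) → Card Q n
card-map {P = P} {Q} P# f P⇒Q inj surj = record
  { elements = map f (elements P#)
  ; unique   = map-unique⁺ inj (All.tabulate (sound P#)) (unique P#)
  ; sound    = λ y∈ → sound′ (∈-map⁻ f y∈)
  ; exhaustive = λ qy → exhaustive′ (surj qy)
  ; size     = trans (List.length-map f (elements P#)) (size P#)
  }
  where
  sound′ : ∀ {y} → (∃ λ x → x ∈ elements P# × y ≡ f x) → Q y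
  sound′ (x , x∈ , refl) = P⇒Q (sound P# x∈)
  exhaustive′ : ∀ {y} → (∃ λ x → P x × f x ≡ y) → y ∈ map f (elements P#)
  exhaustive′ (x , px , refl) = ∈-map⁺ f (exhaustive P# px)

card-⇔ : {P : A → Set ℓp} {Q : A → Set ℓq} {n : ℕ} → Card P n →
  (∀ {x} → P x → Q x) → (∀ {x} → Q x → P x) → Card Q n
card-⇔ P# P⇒Q Q⇒P = card-map P# id P⇒Q (λ _ _ → id) (λ qy → _ , Q⇒P qy , refl)

length-cartesianProduct : (xs : List A) (ys : List B) →
  length (cartesianProduct xs ys) ≡ length xs ℕ.* length ys
length-cartesianProduct []       ys = refl
length-cartesianProduct (x ∷ xs) ys = trans (List.length-++ (map (x ,_) ys))
  (cong₂ ℕ._+_ (List.length-map (x ,_) ys) (length-cartesianProduct xs ys))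

card-× : {P : A → Set ℓp} {Q : B → Set ℓq} {m n : ℕ} → Card P m → Card Q n →
  Card (λ (xy : A × B) → P (proj₁ xy) × Q (proj₂ xy)) (m ℕ.* n)
card-× P# Q# = record
  { elements = cartesianProduct (elements P#) (elements Q#)
  ; unique   = Unique.cartesianProduct⁺ (unique P#) (unique Q#)
  ; sound    = λ xy∈ → let x∈ , y∈ = ∈-cartesianProduct⁻ (elements P#) (elements Q#) xy∈
                       in sound P# x∈ , sound Q# y∈
  ; exhaustive = λ (px , qy) → ∈-cartesianProduct⁺ (exhaustive P# px) (exhaustive Q# qy)
  ; size     = trans (length-cartesianProduct (elements P#) (elements Q#)) (cong₂ ℕ._*_ (size P#) (size Q#))
  }

card-∅ : {P : A → Set ℓp} → (∀ {x} → ¬ P x) → Card P 0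
card-∅ ¬P = record { elements = [] ; unique = [] ; sound = λ () ; exhaustive = λ px → ⊥-elim (¬P px) ; size = refl }

card-empty : {P : A → Set ℓp} {n : ℕ} → Card P n → (∀ {x} → ¬ P x) → n ≡ 0
card-empty P# ¬P = card-unique P# (card-∅ ¬P)

card-nonempty : {P : A → Set ℓp} {n : ℕ} → Card P n → ∀ {x} → P x → 0 ℕ.< n
card-nonempty P# px = subst (0 ℕ.<_) (size P#) (∈-length (exhaustive P# px))

count : {A : Set ℓa} {P : A → Set ℓp} → Decidable P → List A → ℕ
count P? xs = length (filter P? xs)

-- Distinctness is asked of the images. Colorings are functions, and pointwise agreement does not
-- make them propositionally equal, so they are compared only after `Vec.tabulate` has turned them
-- into vectors.
card-image : {P : A → Set ℓp} {Q : B → Set ℓq} (P? : Decidable P) (f : A → B) (xs : List A) →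
  Unique (map f xs) → (∀ {x} → x ∈ xs → P x → Q (f x)) →
  (∀ {y} → Q y → ∃ λ x → x ∈ xs × P x × f x ≡ y) → Card Q (count P? xs)
card-image {P = P} {Q} P? f xs fxs! P⇒Q surj = record
  { elements = map f (filter P? xs)
  ; unique   = AllPairs.map⁺ (AllPairs.filter⁺ P? (AllPairs.map⁻ fxs!))
  ; sound    = λ y∈ → sound′ (∈-map⁻ f y∈)
  ; exhaustive = λ qy → exhaustive′ (surj qy)
  ; size     = List.length-map f (filter P? xs)
  }
  where
  sound′ : ∀ {y} → (∃ λ x → x ∈ filter P? xs × y ≡ f x) → Q y
  sound′ (x , x∈ , refl) = let x∈xs , px = ∈-filter⁻ P? x∈ in P⇒Q x∈xs px
  exhaustive′ : ∀ {y} → (∃ λ x → x ∈ xs × P x × f x ≡ y) → y ∈ map f (filter P? xs)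
  exhaustive′ (x , x∈ , px , refl) = ∈-map⁺ f (∈-filter⁺ P? x∈ px)

card-filter : {P : A → Set ℓp} {Q : A → Set ℓq} {n : ℕ} (P# : Card P n) (Q? : Decidable Q) →
  Card (λ x → P x × Q x) (count Q? (elements P#))
card-filter P# Q? = card-image Q? id (elements P#)
  (subst Unique (sym (List.map-id (elements P#))) (unique P#))
  (λ x∈ qx → sound P# x∈ , qx) (λ (px , qx) → _ , exhaustive P# px , qx , refl)

count-⊎ : {P : A → Set ℓp} {Q : A → Set ℓq} {R : A → Set ℓr}
  (P? : Decidable P) (Q? : Decidable Q) (R? : Decidable R) →
  (∀ {x} → R x → P x ⊎ Q x) → (∀ {x} → P x → R x) → (∀ {x} → Q x → R x) → (∀ {x} → P x → Q x → ⊥) →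
  ∀ xs → count R? xs ≡ count P? xs ℕ.+ count Q? xs
count-⊎ P? Q? R? R⇒ P⇒ Q⇒ ⊥⇒ [] = refl
count-⊎ P? Q? R? R⇒ P⇒ Q⇒ ⊥⇒ (x ∷ xs) with ih ← count-⊎ P? Q? R? R⇒ P⇒ Q⇒ ⊥⇒ xs | P? x | Q? x | R? x
... | yes px | yes qx | _      = ⊥-elim (⊥⇒ px qx)
... | yes px | no ¬qx | yes rx = cong suc ih
... | yes px | no ¬qx | no ¬rx = contradiction (P⇒ px) ¬rx
... | no ¬px | yes qx | yes rx = trans (cong suc ih) (sym (ℕ.+-suc _ _))
... | no ¬px | yes qx | no ¬rx = contradiction (Q⇒ qx) ¬rx
... | no ¬px | no ¬qx | no ¬rx = ih
... | no ¬px | no ¬qx | yes rx with R⇒ rx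
...   | inj₁ px = contradiction px ¬px
...   | inj₂ qx = contradiction qx ¬qx

card-split : {P : A → Set ℓp} {Q : A → Set ℓq} {n i j : ℕ} → Decidable Q →
  Card P n → Card (λ x → P x × Q x) i → Card (λ x → P x × ¬ Q x) j → n ≡ i ℕ.+ j
card-split {P = P} {Q} Q? P# PQ# P¬Q# = begin
  _ ≡⟨ sym (size P#) ⟩
  length (elements P#) ≡⟨ cong length (sym (List.filter-all U? {elements P#} (All.tabulate (λ _ → _)))) ⟩
  count U? (elements P#) ≡⟨ count-⊎ Q? (¬? ∘ Q?) U? dec _ _ (λ qx ¬qx → ¬qx qx) (elements P#) ⟩
  count Q? (elements P#) ℕ.+ count (¬? ∘ Q?) (elements P#)
    ≡⟨ cong₂ ℕ._+_ (card-unique (card-filter P# Q?) PQ#) (card-unique (card-filter P# (¬? ∘ Q?)) P¬Q#) ⟩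
  _ ∎
  where
  open ≡-Reasoning
  dec : ∀ {x} → U x → Q x ⊎ ¬ Q x
  dec {x} _ with Q? x
  ... | yes qx = inj₁ qx
  ... | no ¬qx = inj₂ ¬qx

-- Rational sums and alternating sums

toℚᵘ-fromℕ : ∀ m → ℚ.toℚᵘ (fromℕ m) ℚᵘ.≃ ℚᵘ.mkℚᵘ (ℤ.+ m) 0
toℚᵘ-fromℕ m = ℚ.toℚᵘ-fromℚᵘ (ℚᵘ.mkℚᵘ (ℤ.+ m) 0)

fromℕ-+ : ∀ m n → fromℕ (m ℕ.+ n) ≡ fromℕ m + fromℕ n
fromℕ-+ m n = ℚ.toℚᵘ-injective (begin
  ℚ.toℚᵘ (fromℕ (m ℕ.+ n)) ≈⟨ toℚᵘ-fromℕ (m ℕ.+ n) ⟩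
  ℚᵘ.mkℚᵘ (ℤ.+ (m ℕ.+ n)) 0
    ≈⟨ ℚᵘ.*≡* (cong (ℤ._* ℤ.+ 1) (sym (cong₂ ℤ._+_ (ℤ.*-identityʳ (ℤ.+ m)) (ℤ.*-identityʳ (ℤ.+ n))))) ⟩
  ℚᵘ.mkℚᵘ (ℤ.+ m) 0 ℚᵘ.+ ℚᵘ.mkℚᵘ (ℤ.+ n) 0
    ≈⟨ ℚᵘ.+-cong (ℚᵘ.≃-sym (toℚᵘ-fromℕ m)) (ℚᵘ.≃-sym (toℚᵘ-fromℕ n)) ⟩
  ℚ.toℚᵘ (fromℕ m) ℚᵘ.+ ℚ.toℚᵘ (fromℕ n) ≈⟨ ℚᵘ.≃-sym (ℚ.toℚᵘ-homo-+ (fromℕ m) (fromℕ n)) ⟩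
  ℚ.toℚᵘ (fromℕ m + fromℕ n) ∎)
  where open import Relation.Binary.Reasoning.Setoid ℚᵘ.≃-setoid

fromℕ-nonNeg : ∀ m → 0ℚ ≤ fromℕ m
fromℕ-nonNeg m = ℚ.nonNegative⁻¹ (fromℕ m) {{ℚ.normalize-nonNeg m 1}}

fromℕ-pos : ∀ {m} → 0 ℕ.< m → 0ℚ ℚ.< fromℕ m
fromℕ-pos {suc m} _ = ℚ.positive⁻¹ (fromℕ (suc m)) {{ℚ.normalize-pos (suc m) 1}}

∑ : {A : Set ℓa} → (A → ℚ) → List A → ℚ
∑ f xs = foldr _+_ 0ℚ (map f xs)

interchange : ∀ a b c d → (a + b) + (c + d) ≡ (a + c) + (b + d)
interchange = solve 4 (λ a b c d → (a :+ b) :+ (c :+ d) := (a :+ c) :+ (b :+ d)) refl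
  where open +-*-Solver

∑-cong : {f g : A → ℚ} → (∀ x → f x ≡ g x) → ∀ xs → ∑ f xs ≡ ∑ g xs
∑-cong f≗g []       = refl
∑-cong f≗g (x ∷ xs) = cong₂ _+_ (f≗g x) (∑-cong f≗g xs)

∑-+ : (f g : A → ℚ) → ∀ xs → ∑ (λ x → f x + g x) xs ≡ ∑ f xs + ∑ g xs
∑-+ f g []       = refl
∑-+ f g (x ∷ xs) = trans (cong (f x + g x +_) (∑-+ f g xs)) (interchange (f x) (g x) (∑ f xs) (∑ g xs))

∑-* : (c : ℚ) (f : A → ℚ) → ∀ xs → ∑ (λ x → c * f x) xs ≡ c * ∑ f xs
∑-* c f []       = sym (ℚ.*-zeroʳ c)
∑-* c f (x ∷ xs) = trans (cong (c * f x +_) (∑-* c f xs)) (sym (ℚ.*-distribˡ-+ c (f x) (∑ f xs)))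

∑-0 : {f : A → ℚ} {xs : List A} → (∀ {x} → x ∈ xs → f x ≡ 0ℚ) → ∑ f xs ≡ 0ℚ
∑-0 {xs = []}     f≡0 = refl
∑-0 {xs = x ∷ xs} f≡0 = cong₂ _+_ (f≡0 (here refl)) (∑-0 (f≡0 ∘ there))

∑-single : {f : A → ℚ} {xs : List A} {y : A} → Unique xs → y ∈ xs →
  (∀ {x} → x ∈ xs → x ≢ y → f x ≡ 0ℚ) → ∑ f xs ≡ f y
∑-single {f = f} {x ∷ xs} (x∉xs ∷ _) (here refl) f≡0 =
  trans (cong (f x +_) (∑-0 (λ z∈ → f≡0 (there z∈) (λ z≡x → All.lookup x∉xs z∈ (sym z≡x))))) (ℚ.+-identityʳ (f x))
∑-single {f = f} {x ∷ xs} (x∉xs ∷ xs!) (there y∈xs) f≡0 =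
  trans (cong₂ _+_ (f≡0 (here refl) (All.lookup x∉xs y∈xs)) (∑-single xs! y∈xs (f≡0 ∘ there))) (ℚ.+-identityˡ _)

-- Fibres of `f` over distinct values are disjoint, so no `x` is counted twice on the left. With
-- exponent vectors as `ys`, a sum of monomial coefficients becomes a single count.
∑-count : {P : A → Set ℓp} (P? : Decidable P) (_≟_ : DecidableEquality B) (f : A → B) (xs : List A) →
  let open DecMembership _≟_ using (_∈?_) in
  ∀ {ys} → Unique ys →
  ∑ (λ y → fromℕ (count (λ x → P? x ×-dec (f x ≟ y)) xs)) ys ≡ fromℕ (count (λ x → P? x ×-dec (f x ∈? ys)) xs)
∑-count P? _≟_ f xs [] = cong (fromℕ ∘ length) (sym (List.filter-none _ (All.tabulate {xs = xs} (λ _ → λ ()))))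
∑-count P? _≟_ f xs {y ∷ ys} (y∉ys ∷ ys!) = begin
  fromℕ (count F xs) + ∑ _ ys          ≡⟨ cong (fromℕ (count F xs) +_) (∑-count P? _≟_ f xs ys!) ⟩
  fromℕ (count F xs) + fromℕ (count G xs) ≡⟨ sym (fromℕ-+ (count F xs) (count G xs)) ⟩
  fromℕ (count F xs ℕ.+ count G xs)     ≡⟨ cong fromℕ (sym (count-⊎ F G (λ x → P? x ×-dec (f x ∈? (y ∷ ys)))
    (λ { (px , here fx≡y) → inj₁ (px , fx≡y) ; (px , there fx∈) → inj₂ (px , fx∈) })
    (λ (px , fx≡y) → px , here fx≡y) (λ (px , fx∈) → px , there fx∈)
    (λ { (_ , refl) (_ , fx∈) → All.All¬⇒¬Any y∉ys fx∈ }) xs)) ⟩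
  fromℕ (count (λ x → P? x ×-dec (f x ∈? (y ∷ ys))) xs) ∎
  where
  open ≡-Reasoning
  open DecMembership _≟_ using (_∈?_)
  F = λ x → P? x ×-dec (f x ≟ y)
  G = λ x → P? x ×-dec (f x ∈? ys)

-- Σ_{m ≤ n} (-1)^(n-m) f(m)
alternating : (ℕ → ℚ) → ℕ → ℚ
alternating f zero    = f 0
alternating f (suc n) = f (suc n) - alternating f n

alternating-cong : {f g : ℕ → ℚ} → (∀ m → f m ≡ g m) → ∀ n → alternating f n ≡ alternating g n
alternating-cong f≗g zero    = f≗g 0
alternating-cong f≗g (suc n) = cong₂ _-_ (f≗g (suc n)) (alternating-cong f≗g n)

alternating-+ : (f g : ℕ → ℚ) → ∀ n → alternating (λ m → f m + g m) n ≡ alternating f n + alternating g n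
alternating-+ f g zero    = refl
alternating-+ f g (suc n) = begin
  f (suc n) + g (suc n) - alternating (λ m → f m + g m) n
    ≡⟨ cong (λ z → f (suc n) + g (suc n) - z) (alternating-+ f g n) ⟩
  f (suc n) + g (suc n) - (alternating f n + alternating g n)
    ≡⟨ cong (f (suc n) + g (suc n) +_) (ℚ.neg-distrib-+ (alternating f n) (alternating g n)) ⟩
  f (suc n) + g (suc n) + (- alternating f n + - alternating g n)
    ≡⟨ interchange (f (suc n)) (g (suc n)) (- alternating f n) (- alternating g n) ⟩
  alternating f (suc n) + alternating g (suc n) ∎
  where open ≡-Reasoning

alternating-* : (c : ℚ) (f : ℕ → ℚ) → ∀ n → alternating (λ m → c * f m) n ≡ c * alternating f n
alternating-* c f zero    = refl
alternating-* c f (suc n) = begin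
  c * f (suc n) - alternating (λ m → c * f m) n ≡⟨ cong (λ z → c * f (suc n) - z) (alternating-* c f n) ⟩
  c * f (suc n) - c * alternating f n           ≡⟨ cong (c * f (suc n) +_) (ℚ.neg-distribʳ-* c (alternating f n)) ⟩
  c * f (suc n) + c * - alternating f n         ≡⟨ sym (ℚ.*-distribˡ-+ c (f (suc n)) (- alternating f n)) ⟩
  c * alternating f (suc n)                     ∎
  where open ≡-Reasoning

-- Each f(m) with 0 < m ≤ n appears twice, with opposite signs; the ends are f(n+1) and ± f(0).
alternating-telescope : (f : ℕ → ℚ) → f 0 ≡ 0ℚ → ∀ n → alternating (λ m → f (suc m) + f m) n ≡ f (suc n)
alternating-telescope f f0≡0 zero    = trans (cong (f 1 +_) f0≡0) (ℚ.+-identityʳ (f 1))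
alternating-telescope f f0≡0 (suc n) = trans
  (cong (λ z → f (suc (suc n)) + f (suc n) - z) (alternating-telescope f f0≡0 n))
  (x+y-y≡x (f (suc (suc n))) (f (suc n)))
  where
  open +-*-Solver
  x+y-y≡x : ∀ x y → x + y - y ≡ x
  x+y-y≡x = solve 2 (λ x y → x :+ y :- y := x) refl

alternating-vanishing : {f : ℕ → ℚ} {n : ℕ} → (∀ {m} → m ℕ.< n → f m ≡ 0ℚ) → alternating f n ≡ f n
alternating-vanishing {n = zero}  f≡0 = refl
alternating-vanishing {f} {suc n} f≡0 = begin
  f (suc n) - alternating f n ≡⟨ cong (λ z → f (suc n) - z) (alternating-vanishing (f≡0 ∘ ℕ.m<n⇒m<1+n)) ⟩
  f (suc n) - f n             ≡⟨ cong (λ z → f (suc n) - z) (f≡0 ℕ.≤-refl) ⟩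
  f (suc n) - 0ℚ              ≡⟨ ℚ.+-identityʳ (f (suc n)) ⟩
  f (suc n)                   ∎
  where open ≡-Reasoning

-- Enumeration of words

choices-unique : {A : Set} {xss : List (List A)} → All Unique xss → Unique (choices xss)
choices-unique []           = [] ∷ []
choices-unique (xs! ∷ xss!) = Unique.cartesianProductWith⁺ _∷_ List.∷-injective xs! (choices-unique xss!)

∈-choices⁺ : {A : Set} {w : List A} {xss : List (List A)} → Pointwise _∈_ w xss → w ∈ choices xss
∈-choices⁺ []         = here refl
∈-choices⁺ (x∈ ∷ w∈) = ∈-cartesianProductWith⁺ _∷_ x∈ (∈-choices⁺ w∈)

∈-choices⁻ : {A : Set} {w : List A} (xss : List (List A)) → w ∈ choices xss → Pointwise _∈_ w xss
∈-choices⁻ []         (here refl) = []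
∈-choices⁻ (xs ∷ xss) w∈ with _ , _ , x∈ , v∈ , refl ← ∈-cartesianProductWith⁻ _∷_ xs (choices xss) w∈ =
  x∈ ∷ ∈-choices⁻ xss v∈

words-unique : {A : Set} {xs : List A} → Unique xs → ∀ m → Unique (words xs m)
words-unique xs! m = choices-unique (All.replicate⁺ m xs!)

∈-words⁺ : {A : Set} {xs w : List A} → All (_∈ xs) w → w ∈ words xs (length w)
∈-words⁺ w⊆xs = ∈-choices⁺ (pointwise w⊆xs)
  where
  pointwise : ∀ {w} → All (_∈ _) w → Pointwise _∈_ w (List.replicate (length w) _)
  pointwise []         = []
  pointwise (x∈ ∷ w⊆) = x∈ ∷ pointwise w⊆

∈-words⁻ : {A : Set} {xs w : List A} → ∀ m → w ∈ words xs m → length w ≡ m × All (_∈ xs) w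
∈-words⁻ m w∈ = split m (∈-choices⁻ _ w∈)
  where
  split : ∀ m {w} → Pointwise _∈_ w (List.replicate m _) → length w ≡ m × All (_∈ _) w
  split zero    []        = refl , []
  split (suc m) (x∈ ∷ w∈) = let eq , w⊆ = split m w∈ in cong suc eq , x∈ ∷ w⊆

-- The pairing with eₙ

-- Positive entries give compositions with m parts; the bound n makes the list finite and excludes
-- no composition of n.
exponents : ℕ → ∀ m → List (Vec ℕ m)
exponents n zero    = [] ∷ []
exponents n (suc m) = cartesianProductWith _∷_ (map suc (upTo n)) (exponents n m)

exponents-unique : ∀ n m → Unique (exponents n m)
exponents-unique n zero    = [] ∷ []
exponents-unique n (suc m) = Unique.cartesianProductWith⁺ _∷_ Vec.∷-injective
  (Unique.map⁺ ℕ.suc-injective (Unique.upTo⁺ n)) (exponents-unique n m)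

∈-exponents⁺ : ∀ {n m} (α : Vec ℕ m) → (∀ i → 0 ℕ.< Vec.lookup α i × Vec.lookup α i ℕ.≤ n) → α ∈ exponents n m
∈-exponents⁺ []      bounds = here refl
∈-exponents⁺ (a ∷ α) bounds = ∈-cartesianProductWith⁺ _∷_ (∈-suc (bounds zero)) (∈-exponents⁺ α (bounds ∘ suc))
  where
  ∈-suc : ∀ {a n} → 0 ℕ.< a × a ℕ.≤ n → a ∈ map suc (upTo n)
  ∈-suc {suc a} (_ , a<n) = ∈-map⁺ suc (∈-upTo⁺ a<n)

∈-exponents⁻ : ∀ {n m} {α : Vec ℕ m} → α ∈ exponents n m → ∀ i → 0 ℕ.< Vec.lookup α i
∈-exponents⁻ {n} {suc m} α∈ i
  with _ , _ , a∈ , α∈′ , refl ← ∈-cartesianProductWith⁻ _∷_ (map suc (upTo n)) (exponents n m) α∈ | i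
... | suc i′ = ∈-exponents⁻ α∈′ i′
... | zero with _ , _ , refl ← ∈-map⁻ suc a∈ = s≤s z≤n

-- Together with `content∈exponents⁻`: a word of length n has its exponent vector in `exponents n m`
-- exactly when all m letters occur in it. This is how the restriction to compositions becomes
-- surjectivity, for colorings and for tableaux alike.
content∈exponents⁺ : ∀ {n m} {w : List (Fin m)} → length w ≡ n → (∀ i → i ∈ w) → content w ∈ exponents n m
content∈exponents⁺ {w = w} refl surj = ∈-exponents⁺ (content w) λ i →
  subst (λ z → 0 ℕ.< z × z ℕ.≤ length w) (sym (Vec.lookup∘tabulate _ i))
    (∈-length (∈-filter⁺ (i Fin.≟_) (surj i) refl) , List.length-filter (i Fin.≟_) w)

∈-content : ∀ {m} {w : List (Fin m)} {i} → 0 ℕ.< Vec.lookup (content w) i → i ∈ w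
∈-content {w = w} {i} pos = occurs (subst (0 ℕ.<_) (Vec.lookup∘tabulate _ i) pos)
  where
  occurs : 0 ℕ.< length (filter (i Fin.≟_) w) → i ∈ w
  occurs pos with filter (i Fin.≟_) w in eq
  ... | j ∷ _ with j∈w , refl ← ∈-filter⁻ (i Fin.≟_) {xs = w} (subst (j ∈_) (sym eq) (here refl)) = j∈w

content∈exponents⁻ : ∀ {n m} {w : List (Fin m)} → content w ∈ exponents n m → ∀ i → i ∈ w
content∈exponents⁻ α∈ i = ∈-content (∈-exponents⁻ α∈ i)

-- As eₙ = Σ_α (-1)^(n-ℓ(α)) h_α over the compositions α of n, and ⟨F , h_α⟩ is the coefficient
-- of x^α in F, this is ⟨F , eₙ⟩.  Exponent vectors of the wrong degree are included, but contribute
-- nothing when F is homogeneous of degree n.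
⟨_,e_⟩ : Series → ℕ → ℚ
⟨ F ,e n ⟩ = alternating (λ m → ∑ (λ α → F α) (exponents n m)) n

pairing-cong : ∀ {n} {F H : Series} → F ≈ H → ⟨ F ,e n ⟩ ≡ ⟨ H ,e n ⟩
pairing-cong {n} F≈H = alternating-cong (λ m → ∑-cong F≈H (exponents n m)) n

pairing-+ : ∀ n (F H : Series) → ⟨ (λ α → F α + H α) ,e n ⟩ ≡ ⟨ F ,e n ⟩ + ⟨ H ,e n ⟩
pairing-+ n F H = trans (alternating-cong (λ m → ∑-+ F H (exponents n m)) n) (alternating-+ _ _ n)

pairing-· : ∀ n c (F : Series) → ⟨ c · F ,e n ⟩ ≡ c * ⟨ F ,e n ⟩
pairing-· n c F = trans (alternating-cong (λ m → ∑-* c F (exponents n m)) n) (alternating-* c _ n)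

pairing-0 : ∀ n → ⟨ (λ _ → 0ℚ) ,e n ⟩ ≡ 0ℚ
pairing-0 n = trans (alternating-vanishing {n = n} (λ {m} _ → ∑-0 {xs = exponents n m} (λ _ → refl)))
  (∑-0 {xs = exponents n n} (λ _ → refl))

pairing-∑ : ∀ n (c : List ℕ → ℚ) μs →
  ⟨ (λ α → ∑ (λ μ → c μ * s μ α) μs) ,e n ⟩ ≡ ∑ (λ μ → c μ * ⟨ s μ ,e n ⟩) μs
pairing-∑ n c []       = pairing-0 n
pairing-∑ n c (μ ∷ μs) = trans (pairing-+ n (c μ · s μ) (λ α → ∑ (λ μ → c μ * s μ α) μs))
  (cong₂ _+_ (pairing-· n (c μ) (s μ)) (pairing-∑ n c μs))

-- `X G` and `s μ` have the same form, a decidable condition together with a weight, so one lemma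
-- turns both pairings into signed counts.
pairing-count : ∀ n {B : ℕ → Set ℓa} {P : ∀ {m} → B m → Set ℓp} (P? : ∀ {m} → Decidable (P {m}))
  (weight : ∀ {m} → B m → Vec ℕ m) (xs : ∀ m → List (B m)) →
  ⟨ (λ {m} α → fromℕ (count (λ x → P? x ×-dec (weight x ≟ᵉ α)) (xs m))) ,e n ⟩ ≡
  alternating (λ m → fromℕ (count (λ x → P? x ×-dec DecMembership._∈?_ _≟ᵉ_ (weight x) (exponents n m)) (xs m))) n
pairing-count n P? weight xs = alternating-cong (λ m → ∑-count P? _≟ᵉ_ weight (xs m) (exponents-unique n m)) n

-- Surjective proper colorings

funToFin-cong : ∀ {n k} {f g : Fin n → Fin k} → f ≗ g → funToFin f ≡ funToFin g
funToFin-cong {zero}  f≗g = refl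
funToFin-cong {suc n} f≗g = cong₂ Fin.combine (f≗g zero) (funToFin-cong (f≗g ∘ suc))

finToFun-injective : ∀ {n k} {i j : Fin (k ℕ.^ n)} → finToFun {k} {n} i ≗ finToFun j → i ≡ j
finToFun-injective {n} {k} {i} {j} eq =
  trans (sym (Fin.funToFin-finToFin {n} {k} i)) (trans (funToFin-cong eq) (Fin.funToFin-finToFin {n} {k} j))

tabulate-injective : ∀ {A : Set} {n} {f g : Fin n → A} → Vec.tabulate f ≡ Vec.tabulate g → f ≗ g
tabulate-injective {f = f} {g} eq i =
  trans (sym (Vec.lookup∘tabulate f i)) (trans (cong (λ v → lookup v i) eq) (Vec.lookup∘tabulate g i))

vectors-unique : ∀ n k → Unique (map Vec.tabulate (colorings n k))
vectors-unique n k = subst Unique (List.map-∘ (allFin (k ℕ.^ n)))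
  (Unique.map⁺ (finToFun-injective {n} {k} ∘ tabulate-injective) (Unique.allFin⁺ (k ℕ.^ n)))

coloring : ∀ {n k} (v : Vec (Fin k) n) → ∃ λ κ → κ ∈ colorings n k × κ ≗ lookup v
coloring v = finToFun (funToFin (lookup v)) , ∈-map⁺ finToFun (∈-allFin _) , Fin.finToFun-funToFin (lookup v)

tabulate-lookup : ∀ {A : Set} {n} {f : Fin n → A} {v : Vec A n} → f ≗ lookup v → Vec.tabulate f ≡ v
tabulate-lookup {v = v} eq = trans (Vec.tabulate-cong eq) (Vec.tabulate∘lookup v)

-- A list of pairs may contain loops and repeated edges. Contraction can create both, so the
-- induction takes place here and not on `Graph`.
Edges : ℕ → Set
Edges n = List (Fin n × Fin n)

Respects : ∀ {n k} → Edges n → Vec (Fin k) n → Set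
Respects es v = All (λ (x , y) → lookup v x ≢ lookup v y) es

Onto : ∀ {n k} → Vec (Fin k) n → Set
Onto v = ∀ c → ∃ λ x → lookup v x ≡ c

ProperOnto : ∀ {n k} → Edges n → Vec (Fin k) n → Set
ProperOnto es v = Respects es v × Onto v

properOnto? : ∀ {n k} (es : Edges n) → Decidable (ProperOnto {n} {k} es)
properOnto? es v = All.all? (λ (x , y) → ¬? (lookup v x Fin.≟ lookup v y)) es
  ×-dec Fin.all? (λ c → Fin.any? (λ x → lookup v x Fin.≟ c))

vectors : ∀ n k → List (Vec (Fin k) n)
vectors n k = map Vec.tabulate (colorings n k)

∈-vectors : ∀ {n k} (v : Vec (Fin k) n) → v ∈ vectors n k
∈-vectors v with κ , κ∈ , eq ← coloring v = subst (_∈ vectors _ _) (tabulate-lookup eq) (∈-map⁺ Vec.tabulate κ∈)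

#properOnto : ∀ n → Edges n → ℕ → ℕ
#properOnto n es k = count (properOnto? es) (vectors n k)

card-properOnto : ∀ n (es : Edges n) k → Card (ProperOnto {k = k} es) (#properOnto n es k)
card-properOnto n es k = card-image (properOnto? es) id (vectors n k)
  (subst Unique (sym (List.map-id (vectors n k))) (vectors-unique n k))
  (λ _ p → p) (λ p → _ , ∈-vectors _ , p , refl)

onto⇒≤ : ∀ {n k} {v : Vec (Fin k) n} → Onto v → k ℕ.≤ n
onto⇒≤ {v = v} onto = Fin.injective⇒≤ {f = proj₁ ∘ onto}
  (λ {c} {d} eq → trans (sym (proj₂ (onto c))) (trans (cong (lookup v) eq) (proj₂ (onto d))))

#properOnto-vanishes : ∀ {n k} (es : Edges n) → n ℕ.< k → #properOnto n es k ≡ 0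
#properOnto-vanishes {n} {k} es n<k = card-empty (card-properOnto n es k) (λ {v} (_ , onto) → ℕ.<⇒≱ n<k (onto⇒≤ {v = v} onto))

-- Deletion and contraction

-- Identifies the vertices x and y; the vertices other than y are renumbered.
merge : ∀ {n} {x y : Fin (suc n)} → y ≢ x → Fin (suc n) → Fin n
merge {x = x} {y} y≢x z with y Fin.≟ z
... | yes _  = punchOut y≢x
... | no y≢z = punchOut y≢z

merge-punchIn : ∀ {n} {x y : Fin (suc n)} (y≢x : y ≢ x) z → merge y≢x (punchIn y z) ≡ z
merge-punchIn {y = y} y≢x z with y Fin.≟ punchIn y z
... | yes y≡ = contradiction (sym y≡) (Fin.punchInᵢ≢i y z)
... | no y≢  = trans (Fin.punchOut-cong y refl) (Fin.punchOut-punchIn y)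

merge-lookup : ∀ {n k} {x y : Fin (suc n)} (y≢x : y ≢ x) {κ : Fin (suc n) → Fin k} →
  κ x ≡ κ y → ∀ z → κ (punchIn y (merge y≢x z)) ≡ κ z
merge-lookup {x = x} {y} y≢x {κ} κx≡κy z with y Fin.≟ z
... | yes refl = trans (cong κ (Fin.punchIn-punchOut y≢x)) κx≡κy
... | no y≢z   = cong κ (Fin.punchIn-punchOut y≢z)

merge-≡ : ∀ {n} {x y : Fin (suc n)} (y≢x : y ≢ x) → merge y≢x x ≡ merge y≢x y
merge-≡ {x = x} {y} y≢x with y Fin.≟ x | y Fin.≟ y
... | yes y≡x | _       = contradiction y≡x y≢x
... | no _    | no y≢y  = contradiction refl y≢y
... | no _    | yes _   = Fin.punchOut-cong y refl

contract : ∀ {n} {x y : Fin (suc n)} → y ≢ x → Edges (suc n) → Edges n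
contract y≢x = map (λ (u , v) → merge y≢x u , merge y≢x v)

-- Sort the colorings for `es` by the colors of x and y. If these differ, the edge may be added. If
-- they agree, the coloring factors through `merge y≢x`; it uses the same colors as its factor, so
-- surjectivity passes both ways.
deletion-contraction : ∀ {n} {x y : Fin (suc n)} (y≢x : y ≢ x) es k →
  #properOnto (suc n) es k ≡ #properOnto (suc n) ((x , y) ∷ es) k ℕ.+ #properOnto n (contract y≢x es) k
deletion-contraction {n} {x} {y} y≢x es k = card-split (λ v → ¬? (lookup v x Fin.≟ lookup v y))
  (card-properOnto (suc n) es k)
  (card-⇔ (card-properOnto (suc n) ((x , y) ∷ es) k)
    (λ { (d ∷ ds , onto) → (ds , onto) , d }) (λ ((ds , onto) , d) → d ∷ ds , onto))
  (card-map (card-properOnto n (contract y≢x es) k) expand (λ {v} → expand-sound {v}) expand-injective expand-surjective)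
  where
  expand : Vec (Fin k) n → Vec (Fin k) (suc n)
  expand v = Vec.tabulate (lookup v ∘ merge y≢x)
  lookup-expand : ∀ v z → lookup (expand v) z ≡ lookup v (merge y≢x z)
  lookup-expand v = Vec.lookup∘tabulate (lookup v ∘ merge y≢x)
  expand-sound : ∀ {v} → ProperOnto (contract y≢x es) v →
    ProperOnto es (expand v) × ¬ (lookup (expand v) x ≢ lookup (expand v) y)
  expand-sound {v} (ds , onto) =
    ( All.map (λ {(u , w)} d → subst₂ _≢_ (sym (lookup-expand v u)) (sym (lookup-expand v w)) d) (All.map⁻ ds)
    , λ c → let z , eq = onto c in punchIn y z ,
        trans (lookup-expand v (punchIn y z)) (trans (cong (lookup v) (merge-punchIn y≢x z)) eq)) ,
    λ d → d (trans (lookup-expand v x) (trans (cong (lookup v) (merge-≡ y≢x)) (sym (lookup-expand v y))))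
  expand-injective : ∀ {v w} → ProperOnto (contract y≢x es) v → ProperOnto (contract y≢x es) w →
    expand v ≡ expand w → v ≡ w
  expand-injective {v} {w} _ _ eq = trans (sym (Vec.tabulate∘lookup v)) (tabulate-lookup (λ z →
    trans (cong (lookup v) (sym (merge-punchIn y≢x z))) (trans (tabulate-injective {f = lookup v ∘ merge y≢x} {lookup w ∘ merge y≢x} eq (punchIn y z))
    (cong (lookup w) (merge-punchIn y≢x z)))))
  expand-surjective : ∀ {w} → ProperOnto es w × ¬ (lookup w x ≢ lookup w y) →
    ∃ λ v → ProperOnto (contract y≢x es) v × expand v ≡ w
  expand-surjective {w} ((ds , onto) , ¬d) =
    v , (All.map⁺ (All.map (λ {(u , u′)} d → subst₂ _≢_ (sym (lookup-v u)) (sym (lookup-v u′)) d) ds) ,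
         λ c → let z , eq = onto c in merge y≢x z , trans (lookup-v z) eq) ,
    tabulate-lookup lookup-v
    where
    v = Vec.tabulate (lookup w ∘ punchIn y)
    wx≡wy : lookup w x ≡ lookup w y
    wx≡wy with lookup w x Fin.≟ lookup w y
    ... | yes eq = eq
    ... | no  d  = contradiction d ¬d
    lookup-v : ∀ z → lookup v (merge y≢x z) ≡ lookup w z
    lookup-v z = trans (Vec.lookup∘tabulate (lookup w ∘ punchIn y) (merge y≢x z)) (merge-lookup y≢x wx≡wy z)

-- Remove the first vertex, of color c. The others either still use all colors or miss exactly c,
-- and in the latter case `punchIn c` identifies their coloring with one onto k colors. The choice
-- of c is free both times, whence the two factors k+1.
#onto-recurrence : ∀ n k → #properOnto (suc n) [] (suc k) ≡
  suc k ℕ.* #properOnto n [] (suc k) ℕ.+ suc k ℕ.* #properOnto n [] k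
#onto-recurrence n k = card-split onto-tail? (card-properOnto (suc n) [] (suc k))
  (card-map (card-× allFin# (card-properOnto n [] (suc k))) (λ (c , v) → c ∷ v)
    (λ {(c , v)} (_ , _ , onto) → ([] , onto-∷ c v onto) , onto)
    (λ _ _ eq → cong₂ _,_ (Vec.∷-injectiveˡ eq) (Vec.∷-injectiveʳ eq))
    λ { {c ∷ v} (_ , onto) → (c , v) , (c , [] , onto) , refl })
  (card-map (card-× allFin# (card-properOnto n [] k)) (λ (c , v) → c ∷ Vec.map (punchIn c) v)
    (λ {(c , v)} (_ , _ , onto) → ([] , insert-onto c v onto) , λ onto-tail → missed c v (onto-tail c))
    (λ {(c , v)} {(d , w)} _ _ eq → inj c d v w eq)
    λ { {c ∷ w} ((_ , onto) , ¬onto-tail) → surj c w onto ¬onto-tail })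
  where
  onto-tail? : Decidable (λ (v : Vec (Fin (suc k)) (suc n)) → Onto (Vec.tail v))
  onto-tail? v = Fin.all? (λ c → Fin.any? (λ x → lookup (Vec.tail v) x Fin.≟ c))
  allFin# : Card (λ (_ : Fin (suc k)) → Fin (suc k)) (suc k)
  allFin# = record { elements = allFin (suc k) ; unique = Unique.allFin⁺ (suc k) ; sound = λ {c} _ → c
                   ; exhaustive = λ _ → ∈-allFin _ ; size = List.length-tabulate id }
  onto-∷ : ∀ c (v : Vec (Fin (suc k)) n) → Onto v → Onto (c ∷ v)
  onto-∷ c v onto d = let z , eq = onto d in suc z , eq
  insert-onto : ∀ c (v : Vec (Fin k) n) → Onto v → Onto (c ∷ Vec.map (punchIn c) v)
  insert-onto c v onto d with c Fin.≟ d
  ... | yes c≡d = zero , c≡d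
  ... | no c≢d  = let z , eq = onto (punchOut c≢d) in
    suc z , trans (Vec.lookup-map z (punchIn c) v) (trans (cong (punchIn c) eq) (Fin.punchIn-punchOut c≢d))
  missed : ∀ c (v : Vec (Fin k) n) → ¬ ∃ λ x → lookup (Vec.map (punchIn c) v) x ≡ c
  missed c v (x , eq) = Fin.punchInᵢ≢i c (lookup v x) (trans (sym (Vec.lookup-map x (punchIn c) v)) eq)
  map-punchIn-injective : ∀ {m} c (v w : Vec (Fin k) m) → Vec.map (punchIn c) v ≡ Vec.map (punchIn c) w → v ≡ w
  map-punchIn-injective c []      []      eq = refl
  map-punchIn-injective c (a ∷ v) (b ∷ w) eq = cong₂ _∷_
    (Fin.punchIn-injective c a b (Vec.∷-injectiveˡ eq)) (map-punchIn-injective c v w (Vec.∷-injectiveʳ eq))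
  inj : ∀ c d (v w : Vec (Fin k) n) → c ∷ Vec.map (punchIn c) v ≡ d ∷ Vec.map (punchIn d) w → (c , v) ≡ (d , w)
  inj c d v w eq with refl ← Vec.∷-injectiveˡ eq = cong (c ,_) (map-punchIn-injective c v w (Vec.∷-injectiveʳ eq))
  surj : ∀ c (w : Vec (Fin (suc k)) n) → Onto (c ∷ w) → ¬ Onto w →
    ∃ λ ((d , v) : Fin (suc k) × Vec (Fin k) n) → (Fin (suc k) × ProperOnto [] v) × d ∷ Vec.map (punchIn d) v ≡ c ∷ w
  surj c w onto ¬onto = (c , v) , (c , [] , onto-v) , cong (c ∷_) map-v
    where
    onto-rest : ∀ {d} → c ≢ d → ∃ λ x → lookup w x ≡ d
    onto-rest {d} c≢d with onto d
    ... | zero  , c≡d = contradiction c≡d c≢d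
    ... | suc x , eq  = x , eq
    c∉w : ∀ x → c ≢ lookup w x
    c∉w x c≡wx = ¬onto full
      where
      full : Onto w
      full d with c Fin.≟ d
      ... | yes c≡d = x , trans (sym c≡wx) c≡d
      ... | no c≢d  = onto-rest c≢d
    v = Vec.tabulate (λ x → punchOut (c∉w x))
    punchIn-v : ∀ x → punchIn c (lookup v x) ≡ lookup w x
    punchIn-v x = trans (cong (punchIn c) (Vec.lookup∘tabulate (λ x → punchOut (c∉w x)) x)) (Fin.punchIn-punchOut (c∉w x))
    map-v : Vec.map (punchIn c) v ≡ w
    map-v = trans (sym (Vec.tabulate∘lookup _)) (tabulate-lookup (λ x → trans (Vec.lookup-map x (punchIn c) v) (punchIn-v x)))
    onto-v : Onto v
    onto-v d = let x , eq = onto-rest (λ c≡ → Fin.punchInᵢ≢i c d (sym c≡)) in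
      x , Fin.punchIn-injective c _ _ (trans (punchIn-v x) eq)

alternating-suc : ∀ (f : ℕ → ℚ) → f 0 ≡ 0ℚ → ∀ n → alternating f (suc n) ≡ alternating (f ∘ suc) n
alternating-suc f f0≡0 zero    = trans (cong (λ z → f 1 - z) f0≡0) (ℚ.+-identityʳ (f 1))
alternating-suc f f0≡0 (suc n) = cong (λ z → f (suc (suc n)) - z) (alternating-suc f f0≡0 n)

+-nonNeg : ∀ {x y} → 0ℚ ≤ x → 0ℚ ≤ y → 0ℚ ≤ x + y
+-nonNeg = ℚ.+-mono-≤

-- For the edgeless graph. With f(k) the number of surjections and g(k) = k f(k), the recurrence
-- reads g(k+1) + g(k) + f(k). The g part telescopes to g(n+1), and the f part is the same sum for
-- one vertex fewer.
alternating-onto-nonNeg : ∀ n → 0ℚ ≤ alternating (λ k → fromℕ (#properOnto n [] k)) n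
alternating-onto-nonNeg zero    = fromℕ-nonNeg (#properOnto 0 [] 0)
alternating-onto-nonNeg (suc n) = subst (0ℚ ≤_) (sym equality)
  (+-nonNeg (fromℕ-nonNeg (suc n ℕ.* #onto (suc n))) (alternating-onto-nonNeg n))
  where
  open ≡-Reasoning
  #onto = #properOnto n []
  f g : ℕ → ℚ
  f k = fromℕ (#onto k)
  g k = fromℕ (k ℕ.* #onto k)
  recurrence : ∀ k → fromℕ (#properOnto (suc n) [] (suc k)) ≡ (g (suc k) + g k) + f k
  recurrence k = begin
    fromℕ (#properOnto (suc n) [] (suc k))  ≡⟨ cong fromℕ (#onto-recurrence n k) ⟩
    fromℕ (suc k ℕ.* #onto (suc k) ℕ.+ (#onto k ℕ.+ k ℕ.* #onto k))
      ≡⟨ fromℕ-+ (suc k ℕ.* #onto (suc k)) (#onto k ℕ.+ k ℕ.* #onto k) ⟩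
    g (suc k) + fromℕ (#onto k ℕ.+ k ℕ.* #onto k)
      ≡⟨ cong (g (suc k) +_) (trans (fromℕ-+ (#onto k) (k ℕ.* #onto k)) (ℚ.+-comm (f k) (g k))) ⟩
    g (suc k) + (g k + f k)                 ≡⟨ sym (ℚ.+-assoc (g (suc k)) (g k) (f k)) ⟩
    (g (suc k) + g k) + f k                 ∎
  no-colors : #properOnto (suc n) [] 0 ≡ 0
  no-colors = card-empty (card-properOnto (suc n) [] 0) λ { {() ∷ _} }
  equality : alternating (λ k → fromℕ (#properOnto (suc n) [] k)) (suc n) ≡ g (suc n) + alternating f n
  equality = begin
    alternating (λ k → fromℕ (#properOnto (suc n) [] k)) (suc n) ≡⟨ alternating-suc (λ k → fromℕ (#properOnto (suc n) [] k)) (cong fromℕ no-colors) n ⟩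
    alternating (λ k → fromℕ (#properOnto (suc n) [] (suc k))) n ≡⟨ alternating-cong recurrence n ⟩
    alternating (λ k → (g (suc k) + g k) + f k) n                ≡⟨ alternating-+ (λ k → g (suc k) + g k) f n ⟩
    alternating (λ k → g (suc k) + g k) n + alternating f n
      ≡⟨ cong (_+ alternating f n) (alternating-telescope g refl n) ⟩
    g (suc n) + alternating f n                                  ∎

-- Deleting and contracting the first edge both leave `l` edges, and the wanted sum is the total of
-- the two resulting ones. The induction is on `l` because the contracted list is not a structural
-- part of the given one.
alternating-proper-nonNeg : ∀ l {n} (es : Edges n) → length es ≡ l →
  0ℚ ≤ alternating (λ k → fromℕ (#properOnto n es k)) n
alternating-proper-nonNeg zero {n} [] _ = alternating-onto-nonNeg n
alternating-proper-nonNeg (suc l) {suc n} ((x , y) ∷ es) eq = by-cases (y Fin.≟ x)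
  where
  open ≡-Reasoning
  f d : ℕ → ℚ
  f k = fromℕ (#properOnto (suc n) ((x , y) ∷ es) k)
  d k = fromℕ (#properOnto (suc n) es k)
  -- A loop, such as contraction makes of a parallel edge, admits no proper coloring.
  loop : y ≡ x → ∀ k → f k ≡ 0ℚ
  loop y≡x k = cong fromℕ (card-empty (card-properOnto (suc n) ((x , y) ∷ es) k)
    λ { {v} (x≢y ∷ _ , _) → x≢y (cong (lookup v) (sym y≡x)) })
  cancel : ∀ a b → a + (0ℚ - b) + b ≡ a
  cancel = solve 2 (λ a b → a :+ (con 0ℚ :- b) :+ b := a) refl
    where open +-*-Solver
  module _ (y≢x : y ≢ x) where
    c : ℕ → ℚ
    c k = fromℕ (#properOnto n (contract y≢x es) k)
    delete : ∀ k → d k ≡ f k + c k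
    delete k = trans (cong fromℕ (deletion-contraction y≢x es k))
      (fromℕ-+ (#properOnto (suc n) ((x , y) ∷ es) k) (#properOnto n (contract y≢x es) k))
    equality : alternating d (suc n) + alternating c n ≡ alternating f (suc n)
    equality = begin
      alternating d (suc n) + alternating c n
        ≡⟨ cong (_+ alternating c n) (trans (alternating-cong delete (suc n)) (alternating-+ f c (suc n))) ⟩
      alternating f (suc n) + (c (suc n) - alternating c n) + alternating c n
        -- The contracted graph has n vertices, so it has no coloring onto n+1 colors. Its sum
        -- carried up to n+1 is therefore the negative of its own sum up to n, and adding the latter
        -- cancels it.
        ≡⟨ cong (λ z → alternating f (suc n) + (z - alternating c n) + alternating c n)
             (cong fromℕ (#properOnto-vanishes (contract y≢x es) ℕ.≤-refl)) ⟩
      alternating f (suc n) + (0ℚ - alternating c n) + alternating c n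
        ≡⟨ cancel (alternating f (suc n)) (alternating c n) ⟩
      alternating f (suc n) ∎
  by-cases : Dec (y ≡ x) → 0ℚ ≤ alternating f (suc n)
  by-cases (yes y≡x) = ℚ.≤-reflexive
    (sym (trans (alternating-vanishing {f} {suc n} (λ {k} _ → loop y≡x k)) (loop y≡x (suc n))))
  by-cases (no y≢x) = subst (0ℚ ≤_) (equality y≢x) (+-nonNeg
    (alternating-proper-nonNeg l es (ℕ.suc-injective eq))
    (alternating-proper-nonNeg l (contract y≢x es) (trans (List.length-map _ es) (ℕ.suc-injective eq))))

-- The pairing of the chromatic symmetric function

edges : ∀ {n} → Graph n → Edges n
edges {n} G = filter (λ (u , v) → u ~? v) (cartesianProduct (allFin n) (allFin n))
  where open Graph G

proper⇒respects : ∀ {n k} (G : Graph n) {κ : Fin n → Fin k} → Proper G κ → Respects (edges G) (Vec.tabulate κ)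
proper⇒respects G {κ} proper = All.tabulate λ {(u , v)} uv∈ → subst₂ _≢_
  (sym (Vec.lookup∘tabulate κ u)) (sym (Vec.lookup∘tabulate κ v))
  (proper u v (proj₂ (∈-filter⁻ (λ (u , v) → u ~? v) {xs = cartesianProduct (allFin _) (allFin _)} uv∈)))
  where open Graph G

respects⇒proper : ∀ {n k} (G : Graph n) {κ : Fin n → Fin k} → Respects (edges G) (Vec.tabulate κ) → Proper G κ
respects⇒proper G {κ} respects u v u~v = subst₂ _≢_ (Vec.lookup∘tabulate κ u) (Vec.lookup∘tabulate κ v)
  (All.lookup respects (∈-filter⁺ (λ (u , v) → u ~? v) (∈-cartesianProduct⁺ (∈-allFin u) (∈-allFin v)) u~v))
  where open Graph G

pairing-X : ∀ {n} (G : Graph n) → ⟨ X G ,e n ⟩ ≡ alternating (λ k → fromℕ (#properOnto n (edges G) k)) n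
pairing-X {n} G = trans (pairing-count n (proper? G) (content ∘ List.tabulate) (colorings n))
  (alternating-cong (λ k → cong fromℕ (card-unique
    (card-image _ Vec.tabulate (colorings n k) (vectors-unique n k) (λ {κ} _ → sound′ κ) exhaustive′)
    (card-properOnto n (edges G) k))) n)
  where
  sound′ : ∀ {k} (κ : Fin n → Fin k) → Proper G κ × content (List.tabulate κ) ∈ exponents n k →
    ProperOnto (edges G) (Vec.tabulate κ)
  sound′ κ (proper , content∈) = proper⇒respects G proper , λ c →
    let x , eq = ∈-tabulate⁻ (content∈exponents⁻ {w = List.tabulate κ} content∈ c)
    in x , trans (Vec.lookup∘tabulate κ x) (sym eq)
  exhaustive′ : ∀ {k} {v : Vec (Fin k) n} → ProperOnto (edges G) v → ∃ λ κ →
    κ ∈ colorings n k × (Proper G κ × content (List.tabulate κ) ∈ exponents n k) × Vec.tabulate κ ≡ v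
  exhaustive′ {v = v} (respects , onto) with κ , κ∈ , eq ← coloring v with refl ← tabulate-lookup {f = κ} {v} eq =
    κ , κ∈ , (respects⇒proper G respects ,
      content∈exponents⁺ (List.length-tabulate κ) (λ c → let x , eq′ = onto c in
        subst (_∈ List.tabulate κ) (trans (sym (Vec.lookup∘tabulate κ x)) eq′) (∈-tabulate⁺ x))) , refl

pairing-X-nonNeg : ∀ {n} (G : Graph n) → 0ℚ ≤ ⟨ X G ,e n ⟩
pairing-X-nonNeg G = subst (0ℚ ≤_) (sym (pairing-X G)) (alternating-proper-nonNeg _ (edges G) refl)

-- Tableaux with values 0, …, m-1

-- Entries are natural numbers and the bound m is a separate field of `Tableau`. Fillings with m and
-- with m+1 values then share a type, and raising entries is a plain `map`.
Filling : Set
Filling = List (List ℕ)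

RowsIncrease : Filling → Set
RowsIncrease = All (Linked ℕ._≤_)

ColumnsIncrease : Filling → Set
ColumnsIncrease = Linked (λ upper lower → Prefix ℕ._>_ lower upper)

Occurs : ℕ → Filling → Set
Occurs v = Any (v ∈_)

record Tableau (μ : List ℕ) (m : ℕ) (T : Filling) : Set where
  field
    shape   : map length T ≡ μ
    bounded : All (All (ℕ._< m)) T
    rows    : RowsIncrease T
    columns : ColumnsIncrease T
    onto    : ∀ {v} → v ℕ.< m → Occurs v T

-- A stem is an initial piece of the first column holding consecutive values. The starting value i
-- varies so that induction can descend the rows.
Stem : ℕ → ℕ → Filling → Set
Stem i zero    T             = ⊤
Stem i (suc j) []            = ⊥
Stem i (suc j) ([] ∷ R)      = ⊥
Stem i (suc j) ((a ∷ r) ∷ R) = a ≡ i × Stem (suc i) j R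

stem? : ∀ i j → Decidable (Stem i j)
stem? i zero    T             = yes tt
stem? i (suc j) []            = no λ ()
stem? i (suc j) ([] ∷ R)      = no λ ()
stem? i (suc j) ((a ∷ r) ∷ R) = (a ℕ.≟ i) ×-dec stem? (suc i) j R

mapTail : (ℕ → ℕ) → List ℕ → List ℕ
mapTail f []      = []
mapTail f (a ∷ r) = a ∷ map f r

mapOffStem : (ℕ → ℕ) → ℕ → Filling → Filling
mapOffStem f zero    T       = map (map f) T
mapOffStem f (suc j) []      = []
mapOffStem f (suc j) (r ∷ R) = mapTail f r ∷ mapOffStem f j R

OffStem : (ℕ → Set) → ℕ → Filling → Set
OffStem P zero    T       = All (All P) T
OffStem P (suc j) []      = ⊤
OffStem P (suc j) (r ∷ R) = All P (drop 1 r) × OffStem P j R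

lift lower : ℕ → Filling → Filling
lift  = mapOffStem suc
lower = mapOffStem pred

offStem-map : ∀ {P Q : ℕ → Set} → (∀ {x} → P x → Q x) → ∀ j {T} → OffStem P j T → OffStem Q j T
offStem-map P⇒Q zero            ps       = All.map (All.map P⇒Q) ps
offStem-map P⇒Q (suc j) {[]}    _        = tt
offStem-map P⇒Q (suc j) {_ ∷ _} (p , ps) = All.map P⇒Q p , offStem-map P⇒Q j ps

mapOffStem-inverse : ∀ (f g : ℕ → ℕ) j {T} → OffStem (λ x → f (g x) ≡ x) j T →
  mapOffStem f j (mapOffStem g j T) ≡ T
mapOffStem-inverse f g zero {[]}    []       = refl
mapOffStem-inverse f g zero {r ∷ R} (p ∷ ps) =
  cong₂ _∷_ (trans (sym (List.map-∘ r)) (List.map-id-local p)) (mapOffStem-inverse f g zero ps)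
mapOffStem-inverse f g (suc j) {[]}          _        = refl
mapOffStem-inverse f g (suc j) {[] ∷ R}      (p , ps) = cong ([] ∷_) (mapOffStem-inverse f g j ps)
mapOffStem-inverse f g (suc j) {(a ∷ r) ∷ R} (p , ps) =
  cong₂ _∷_ (cong (a ∷_) (trans (sym (List.map-∘ r)) (List.map-id-local p))) (mapOffStem-inverse f g j ps)

offStem-trivial : ∀ {P : ℕ → Set} → (∀ x → P x) → ∀ j T → OffStem P j T
offStem-trivial p zero    T       = All.universal (All.universal p) T
offStem-trivial p (suc j) []      = tt
offStem-trivial p (suc j) (r ∷ R) = All.universal p (drop 1 r) , offStem-trivial p j R

lower-lift : ∀ j T → lower j (lift j T) ≡ T
lower-lift j T = mapOffStem-inverse pred suc j (offStem-trivial (λ _ → refl) j T)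

lift-lower : ∀ j {T} → OffStem (0 ℕ.<_) j T → lift j (lower j T) ≡ T
lift-lower j pos = mapOffStem-inverse suc pred j (offStem-map (λ { (s≤s _) → refl }) j pos)

mapOffStem-shape : ∀ f j T → map length (mapOffStem f j T) ≡ map length T
mapOffStem-shape f zero    []            = refl
mapOffStem-shape f zero    (r ∷ R)       = cong₂ _∷_ (List.length-map f r) (mapOffStem-shape f zero R)
mapOffStem-shape f (suc j) []            = refl
mapOffStem-shape f (suc j) ([] ∷ R)      = cong (0 ∷_) (mapOffStem-shape f j R)
mapOffStem-shape f (suc j) ((a ∷ r) ∷ R) = cong₂ _∷_ (cong suc (List.length-map f r)) (mapOffStem-shape f j R)

mapOffStem-stem : ∀ f i j T → Stem i j T → Stem i j (mapOffStem f j T)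
mapOffStem-stem f i zero    T             _          = tt
mapOffStem-stem f i (suc j) ((a ∷ r) ∷ R) (eq , st) = eq , mapOffStem-stem f (suc i) j R st

stem-occurs : ∀ i j {T v} → Stem i j T → i ℕ.≤ v → v ℕ.< i ℕ.+ j → Occurs v T
stem-occurs i zero st i≤v v<i+0 = contradiction (subst (_ ℕ.<_) (ℕ.+-identityʳ i) v<i+0) (ℕ.≤⇒≯ i≤v)
stem-occurs i (suc j) {(a ∷ r) ∷ R} {v} (refl , st) i≤v v<i+1+j with ℕ.m≤n⇒m<n∨m≡n i≤v
... | inj₁ i<v  = there (stem-occurs (suc i) j st i<v (subst (v ℕ.<_) (ℕ.+-suc i j) v<i+1+j))
... | inj₂ refl = here (here refl)

mapOffStem-occurs : ∀ f i j T {v} → Stem i j T → i ℕ.+ j ℕ.≤ v → Occurs v T → Occurs (f v) (mapOffStem f j T)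
mapOffStem-occurs f i zero    T _ _ occ = Any.map⁺ (Any.map (∈-map⁺ f) occ)
mapOffStem-occurs f i (suc j) ((a ∷ r) ∷ R) (refl , st) i+1+j≤v (here (here refl)) =
  contradiction (subst (ℕ._≤ i) (ℕ.+-suc i j) i+1+j≤v) (ℕ.<⇒≱ (s≤s (ℕ.m≤m+n i j)))
mapOffStem-occurs f i (suc j) ((a ∷ r) ∷ R) (refl , st) i+1+j≤v (here (there v∈r)) = here (there (∈-map⁺ f v∈r))
mapOffStem-occurs f i (suc j) ((a ∷ r) ∷ R) {v} (refl , st) i+1+j≤v (there occ) =
  there (mapOffStem-occurs f (suc i) j R st (subst (ℕ._≤ v) (ℕ.+-suc i j) i+1+j≤v) occ)

prefix-All : ∀ {c l u} → All (c ℕ.≤_) u → Prefix ℕ._>_ l u → All (suc c ℕ.≤_) l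
prefix-All _        []       = []
prefix-All (p ∷ ps) (q ∷ qs) = ℕ.≤-<-trans p q ∷ prefix-All ps qs

prefix-tail : ∀ {l u} → Prefix ℕ._>_ l u → Prefix ℕ._>_ (drop 1 l) (drop 1 u)
prefix-tail []       = []
prefix-tail (_ ∷ qs) = qs

below : ∀ {c u R} → All (c ℕ.≤_) u → ColumnsIncrease (u ∷ R) → All (All (suc c ℕ.≤_)) R
below ps [-]      = []
below ps (q ∷ qs) = let ps′ = prefix-All ps q in ps′ ∷ below (All.map ℕ.<⇒≤ ps′) qs

-- An entry outside the first column lies below an entry of `drop 1 u`, and columns increase.
tails : ∀ {c u R} → All (c ℕ.≤_) (drop 1 u) → ColumnsIncrease (u ∷ R) → All (All (c ℕ.≤_) ∘ drop 1) (u ∷ R)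
tails ps [-]      = ps ∷ []
tails ps (q ∷ qs) = ps ∷ tails (All.map ℕ.<⇒≤ (prefix-All ps (prefix-tail q))) qs

-- Rows beneath the stem exceed its last head i+j by column strictness, so they obey the bound
-- already assumed for the tails.
off-stem : ∀ i j T → Stem i (suc j) T → ColumnsIncrease T → All (All (i ℕ.+ suc j ℕ.≤_) ∘ drop 1) T →
  OffStem (i ℕ.+ suc j ℕ.≤_) (suc j) T
off-stem i zero ((.i ∷ r) ∷ R) (refl , _) cols (p ∷ _) =
  p , subst (λ c → All (All (c ℕ.≤_)) R) (ℕ.+-comm 1 i)
    (below (ℕ.≤-refl ∷ All.map (ℕ.≤-trans (ℕ.m≤m+n i 1)) p) cols)
off-stem i (suc j) ((.i ∷ r) ∷ R) (refl , st) cols (p ∷ ps) =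
  p , subst (λ c → OffStem (c ℕ.≤_) (suc j) R) (sym (ℕ.+-suc i (suc j)))
    (off-stem (suc i) j R st (Linked.tail cols) (subst (λ c → All (All (c ℕ.≤_) ∘ drop 1) R) (ℕ.+-suc i (suc j)) ps))

-- The value i has only one possible place, the head of the first row: tails start at i+j, and lower
-- rows exceed i. Removing that row leaves the same situation for i+1.
stem-exists : ∀ i j T → ColumnsIncrease T → All (All (i ℕ.≤_)) T → All (All (i ℕ.+ j ℕ.≤_) ∘ drop 1) T →
  (∀ {v} → i ℕ.≤ v → v ℕ.< i ℕ.+ j → Occurs v T) → Stem i j T
stem-exists i zero    T  _ _ _ _ = tt
stem-exists i (suc j) T cols lb tl occ with occ ℕ.≤-refl (ℕ.m<m+n i (s≤s z≤n))
stem-exists i (suc j) (u ∷ R) cols (lb ∷ _) tl occ | there i∈R =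
  ⊥-elim (absurd (below lb cols) i∈R)
  where
  absurd : ∀ {R} → All (All (suc i ℕ.≤_)) R → Occurs i R → ⊥
  absurd (p ∷ _) (here i∈) = ℕ.<-irrefl refl (All.lookup p i∈)
  absurd (_ ∷ p) (there i∈) = absurd p i∈
stem-exists i (suc j) ((a ∷ r) ∷ R) cols lb (p ∷ _) occ | here (there i∈r) =
  contradiction (All.lookup p i∈r) (ℕ.<⇒≱ (ℕ.m<m+n i (s≤s z≤n)))
stem-exists i (suc j) ((.i ∷ r) ∷ R) cols (lb ∷ _) (p ∷ ps) occ | here (here refl) =
  refl , stem-exists (suc i) j R (Linked.tail cols) (below lb cols)
    (subst (λ c → All (All (c ℕ.≤_) ∘ drop 1) R) (ℕ.+-suc i j) ps) occ′
  where
  occ′ : ∀ {v} → suc i ℕ.≤ v → v ℕ.< suc i ℕ.+ j → Occurs v R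
  occ′ {v} i<v v<b with occ (ℕ.<⇒≤ i<v) (subst (v ℕ.<_) (sym (ℕ.+-suc i j)) v<b)
  ... | here (here refl)  = contradiction refl (ℕ.<⇒≢ i<v ∘ sym)
  ... | here (there v∈r)  = contradiction (All.lookup p v∈r) (ℕ.<⇒≱ (subst (v ℕ.<_) (sym (ℕ.+-suc i j)) v<b))
  ... | there v∈R         = v∈R

lift-bounded : ∀ {m} j {T} → All (All (ℕ._< m)) T → All (All (ℕ._< suc m)) (lift j T)
lift-bounded zero    ps       = All.map⁺ (All.map (λ p → All.map⁺ (All.map s≤s p)) ps)
lift-bounded (suc j) []       = []
lift-bounded (suc j) ([] ∷ ps) = [] ∷ lift-bounded j ps
lift-bounded (suc j) ((p ∷ q) ∷ ps) = (ℕ.m<n⇒m<1+n p ∷ All.map⁺ (All.map s≤s q)) ∷ lift-bounded j ps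

map-increasing : ∀ {f : ℕ → ℕ} → (∀ {x y} → x ℕ.≤ y → f x ℕ.≤ f y) → ∀ {r} → Linked ℕ._≤_ r → Linked ℕ._≤_ (map f r)
map-increasing mono inc = Linked.map⁺ (Linked.map mono inc)

lift-rows : ∀ j {T} → RowsIncrease T → RowsIncrease (lift j T)
lift-rows zero    rs             = All.map⁺ (All.map (map-increasing s≤s) rs)
lift-rows (suc j) []             = []
lift-rows (suc j) ([] ∷ rs)      = [] ∷ lift-rows j rs
lift-rows (suc j) ([-] ∷ rs)     = [-] ∷ lift-rows j rs
lift-rows (suc j) ((p ∷ r) ∷ rs) = (ℕ.m≤n⇒m≤1+n p ∷ map-increasing s≤s r) ∷ lift-rows j rs

prefix-suc : ∀ {l u} → Prefix ℕ._>_ l u → Prefix ℕ._>_ (map suc l) (map suc u)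
prefix-suc []       = []
prefix-suc (p ∷ ps) = s≤s p ∷ prefix-suc ps

-- The only place where an unraised entry meets a raised one is at the last stem head, and there it
-- is the lower entry that is raised.
lift-columns : ∀ j {T} → ColumnsIncrease T → ColumnsIncrease (lift j T)
lift-columns zero          cols    = Linked.map⁺ (Linked.map prefix-suc cols)
lift-columns (suc j)       []      = []
lift-columns (suc zero)    [-]     = [-]
lift-columns (suc (suc j)) [-]     = [-]
lift-columns (suc zero)    (p ∷ cols) = off-on p ∷ lift-columns zero cols
  where
  off-on : ∀ {l u} → Prefix ℕ._>_ l u → Prefix ℕ._>_ (map suc l) (mapTail suc u)
  off-on []       = []
  off-on (p ∷ ps) = ℕ.m<n⇒m<1+n p ∷ prefix-suc ps
lift-columns (suc (suc j)) (p ∷ cols) = on-on p ∷ lift-columns (suc j) cols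
  where
  on-on : ∀ {l u} → Prefix ℕ._>_ l u → Prefix ℕ._>_ (mapTail suc l) (mapTail suc u)
  on-on []       = []
  on-on (p ∷ ps) = p ∷ prefix-suc ps

-- The head beneath the stem exceeds the last stem head, so after lifting it exceeds it by at least
-- two and cannot continue the stem.
lift-stem-maximal : ∀ i j T → ColumnsIncrease T → Stem i (suc j) T → ¬ Stem i (suc (suc j)) (lift (suc j) T)
lift-stem-maximal i zero    ((.i ∷ r) ∷ (y ∷ l) ∷ R) ((i<y ∷ _) ∷ _) (refl , _) (_ , eq , _) =
  ℕ.<-irrefl (sym (ℕ.suc-injective eq)) i<y
lift-stem-maximal i (suc j) ((.i ∷ r) ∷ R) cols (refl , st) (_ , st′) =
  lift-stem-maximal (suc i) j R (Linked.tail cols) st st′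

lower-bounded : ∀ {m} i j T → Stem i j T → i ℕ.+ j ℕ.≤ m → OffStem (0 ℕ.<_) j T →
  All (All (ℕ._< suc m)) T → All (All (ℕ._< m)) (lower j T)
lower-bounded {m} i j T st i+j≤m pos bd = go i j T st i+j≤m pos bd
  where
  pred-bounded : ∀ {r} → All (0 ℕ.<_) r → All (ℕ._< suc m) r → All (ℕ._< m) (map pred r)
  pred-bounded []             []             = []
  pred-bounded (s≤s z≤n ∷ ps) (s≤s q ∷ qs) = q ∷ pred-bounded ps qs
  go : ∀ i j T → Stem i j T → i ℕ.+ j ℕ.≤ m → OffStem (0 ℕ.<_) j T →
    All (All (ℕ._< suc m)) T → All (All (ℕ._< m)) (lower j T)
  go i zero    []      _ _ []       []       = []
  go i zero    (r ∷ R) _ b (p ∷ ps) (q ∷ qs) = pred-bounded p q ∷ go i zero R tt b ps qs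
  go i (suc j) ((.i ∷ r) ∷ R) (refl , st) b (p , ps) ((_ ∷ q) ∷ qs) =
    (ℕ.<-≤-trans (ℕ.m<m+n i (s≤s z≤n)) b ∷ pred-bounded p q) ∷ go (suc i) j R st (subst (ℕ._≤ m) (ℕ.+-suc i j) b) ps qs

lower-rows : ∀ {b} i j T → Stem i j T → i ℕ.+ j ℕ.≤ b → OffStem (b ℕ.≤_) j T → RowsIncrease T → RowsIncrease (lower j T)
lower-rows i zero    T _ _ _ rs = All.map⁺ (All.map (map-increasing ℕ.pred-mono-≤) rs)
lower-rows {b} i (suc j) ((.i ∷ r) ∷ R) (refl , st) i+1+j≤b (p , ps) (q ∷ qs) =
  row p q ∷ lower-rows (suc i) j R st (subst (ℕ._≤ b) (ℕ.+-suc i j) i+1+j≤b) ps qs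
  where
  row : ∀ {r} → All (b ℕ.≤_) r → Linked ℕ._≤_ (i ∷ r) → Linked ℕ._≤_ (i ∷ map pred r)
  row []      [-]     = [-]
  row (p ∷ _) (_ ∷ l) =
    ℕ.pred-mono-≤ (ℕ.≤-trans (ℕ.<-≤-trans (ℕ.m<m+n i (s≤s z≤n)) i+1+j≤b) p) ∷ map-increasing ℕ.pred-mono-≤ l

prefix-pred : ∀ {l u} → All (0 ℕ.<_) u → Prefix ℕ._>_ l u → Prefix ℕ._>_ (map pred l) (map pred u)
prefix-pred _              []             = []
prefix-pred (s≤s z≤n ∷ ps) (s≤s q ∷ qs) = q ∷ prefix-pred ps qs

-- The critical pair is the last stem head i+j, which stays, and the entry beneath it, which drops
-- by one. They could collide only if that entry were i+j+1, but then the stem would be one row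
-- longer.
lower-columns : ∀ i j T → Stem i (suc j) T → ¬ Stem i (suc (suc j)) T → OffStem (0 ℕ.<_) (suc j) T →
  ColumnsIncrease T → ColumnsIncrease (lower (suc j) T)
lower-columns i zero    ((.i ∷ u) ∷ []) (refl , _) _ _ _ = [-]
lower-columns i (suc j) ((.i ∷ u) ∷ []) (refl , ()) _ _ _
lower-columns i zero    ((.i ∷ u) ∷ l ∷ R) (refl , _) max (p , ps) (q ∷ qs) =
  head-row l max q ∷ lower-all ps qs
  where
  head-row : ∀ l → ¬ Stem i 2 ((i ∷ u) ∷ l ∷ R) → Prefix ℕ._>_ l (i ∷ u) → Prefix ℕ._>_ (map pred l) (i ∷ map pred u)
  head-row []      _   []       = []
  head-row (y ∷ l) max (q ∷ qs) =
    ℕ.pred-mono-≤ (ℕ.≤∧≢⇒< q (λ eq → max (refl , sym eq , tt))) ∷ prefix-pred p qs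
  lower-all : ∀ {T} → All (All (0 ℕ.<_)) T → ColumnsIncrease T → ColumnsIncrease (map (map pred) T)
  lower-all []          []      = []
  lower-all (_ ∷ [])    [-]     = [-]
  lower-all (p ∷ ps)    (q ∷ qs) = prefix-pred p q ∷ lower-all ps qs
lower-columns i (suc j) ((.i ∷ u) ∷ (a ∷ l) ∷ R) (refl , eq , st) max (p , ps) ((q ∷ qs) ∷ cols) =
  (q ∷ prefix-pred p qs) ∷ lower-columns (suc i) j ((a ∷ l) ∷ R) (eq , st) (λ st′ → max (refl , st′)) ps cols

open Tableau

length-concat : {A : Set} (T : List (List A)) → length (concat T) ≡ sum (map length T)
length-concat []      = refl
length-concat (r ∷ R) = trans (List.length-++ r) (cong (length r ℕ.+_) (length-concat R))

occurs⇒≤ : ∀ {m T} → (∀ {v} → v ℕ.< m → Occurs v T) → m ℕ.≤ sum (map length T)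
occurs⇒≤ {m} {T} occ = subst₂ ℕ._≤_ (List.length-upTo m) (length-concat T)
  (length-⊆ (Unique.upTo⁺ m) (λ v∈ → ∈-concat⁺ (occ (∈-upTo⁻ v∈))))

-- The default 0 is never met by a tableau whose first row has two cells; `wide-view` rules it out.
second : Filling → ℕ
second ((a ∷ b ∷ r) ∷ R) = b
second _                 = 0

-- Values above j sit off the stem and move above j+1, so they leave a gap at j+1 itself. The last
-- hypothesis fills it; in `shift` the raised second entry of the first row does so.
lift-tableau : ∀ {μ m T} j → Tableau μ m T → Stem 0 (suc j) T → Occurs (suc j) (lift (suc j) T) →
  Tableau μ (suc m) (lift (suc j) T)
lift-tableau {μ} {m} {T} j tab st occ = record
  { shape   = trans (mapOffStem-shape suc (suc j) T) (shape tab)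
  ; bounded = lift-bounded (suc j) (bounded tab)
  ; rows    = lift-rows (suc j) (rows tab)
  ; columns = lift-columns (suc j) (columns tab)
  ; onto    = onto′
  }
  where
  onto′ : ∀ {v} → v ℕ.< suc m → Occurs v (lift (suc j) T)
  onto′ {v} v<1+m with v ℕ.≤? j
  ... | yes v≤j = stem-occurs 0 (suc j) (mapOffStem-stem suc 0 (suc j) T st) z≤n (s≤s v≤j)
  onto′ {zero}  v<1+m | no 0≰j = contradiction z≤n 0≰j
  onto′ {suc v} (s≤s v<m) | no 1+v≰j with ℕ.m≤n⇒m<n∨m≡n (ℕ.≤-pred (ℕ.≰⇒> 1+v≰j))
  ... | inj₁ j<v  = mapOffStem-occurs suc 0 (suc j) T st j<v (onto tab v<m)
  ... | inj₂ refl = occ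

lower-tableau : ∀ {μ m T} j → Tableau μ (suc m) T → Stem 0 (suc j) T → ¬ Stem 0 (suc (suc j)) T →
  OffStem (suc j ℕ.≤_) (suc j) T → suc j ℕ.≤ m → Tableau μ m (lower (suc j) T)
lower-tableau {μ} {m} {T} j tab st max off 1+j≤m = record
  { shape   = trans (mapOffStem-shape pred (suc j) T) (shape tab)
  ; bounded = lower-bounded 0 (suc j) T st 1+j≤m pos (bounded tab)
  ; rows    = lower-rows 0 (suc j) T st ℕ.≤-refl off (rows tab)
  ; columns = lower-columns 0 j T st max pos (columns tab)
  ; onto    = onto′
  }
  where
  pos = offStem-map (ℕ.≤-trans (s≤s z≤n)) (suc j) {T} off
  onto′ : ∀ {v} → v ℕ.< m → Occurs v (lower (suc j) T)
  onto′ {v} v<m with v ℕ.≤? j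
  ... | yes v≤j = stem-occurs 0 (suc j) (mapOffStem-stem pred 0 (suc j) T st) z≤n (s≤s v≤j)
  ... | no v≰j  = mapOffStem-occurs pred 0 (suc j) T st (ℕ.m≤n⇒m≤1+n (ℕ.≰⇒> v≰j)) (onto tab (s≤s v<m))

-- Sign-reversing involution: let b be the second entry of the first row.  The entries
-- preceding it in the standardization form a stem, whose last head is either b or b - 1;
-- lifting the remaining entries turns the first case, with m values, into the second, with m + 1.
module _ {μ : List ℕ} {l : ℕ} {μs : List ℕ} (μ-wide : μ ≡ suc (suc l) ∷ μs) where
  private
    n = sum μ

  -- Write b for `second T`. The heads 0, ..., b-1 are always there by `stem-second`; being long
  -- means that b is a head too.
  Long : Filling → Set
  Long T = Stem 0 (suc (second T)) T

  long? : Decidable Long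
  long? T = stem? 0 (suc (second T)) T

  data Wide : Filling → Set where
    wide : ∀ {a b r R} → Wide ((a ∷ b ∷ r) ∷ R)

  wide-view : ∀ {T} → map length T ≡ μ → Wide T
  wide-view {T} eq with T | trans eq μ-wide
  ... | (a ∷ b ∷ r) ∷ R | _ = wide

  second-least : ∀ {m T} → Tableau μ m T → All (All (second T ℕ.≤_) ∘ drop 1) T
  second-least tab with wide-view (shape tab) | rows tab
  ... | wide | (_ ∷ b≤r) ∷ _ = tails (Linked.Linked⇒All ℕ.≤-trans ℕ.≤-refl b≤r) (columns tab)

  second-bounded : ∀ {m T} → Tableau μ m T → second T ℕ.< m
  second-bounded tab with wide-view (shape tab) | bounded tab
  ... | wide | (_ ∷ b<m ∷ _) ∷ _ = b<m

  second-mapOffStem : ∀ {m T} f j → Tableau μ m T → second (mapOffStem f (suc j) T) ≡ f (second T)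
  second-mapOffStem f j tab with wide ← wide-view (shape tab) = refl

  stem-second : ∀ {m T} → Tableau μ m T → Stem 0 (second T) T
  stem-second {m} {T} tab = stem-exists 0 (second T) T (columns tab) (All.universal (All.universal (λ _ → z≤n)) T)
    (second-least tab) (λ _ v<b → onto tab (ℕ.<-trans v<b (second-bounded tab)))

  short-second-pos : ∀ {m T} → Tableau μ m T → ¬ Long T → ∃ λ j → second T ≡ suc j
  short-second-pos {T = T} tab short with wide-view (shape tab) | rows tab
  ... | wide {b = suc b} | _             = b , refl
  -- If b = 0, the row condition forces the corner to be 0 as well, and this head alone makes the
  -- tableau long.
  ... | wide {b = zero}  | (z≤n ∷ _) ∷ _ = contradiction (refl , tt) short

  shift : Filling → Filling
  shift T = lift (suc (second T)) T

  occurs-shift : ∀ {m T} → Tableau μ m T → Occurs (suc (second T)) (shift T)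
  occurs-shift tab with wide ← wide-view (shape tab) = here (there (here refl))

  -- Lifting turns the second entry into b+1 but leaves the stem ending at b, so a long tableau
  -- becomes a short one.
  shift-tableau : ∀ {m T} → Tableau μ m T × Long T → Tableau μ (suc m) (shift T) × ¬ Long (shift T)
  shift-tableau {m} {T} (tab , long) = tab′ , λ long′ →
      lift-stem-maximal 0 b T (columns tab) long (subst (λ c → Stem 0 (suc c) (shift T)) second-shift long′)
    where
    b = second T
    second-shift : second (shift T) ≡ suc b
    second-shift = second-mapOffStem suc b tab
    tab′ = lift-tableau b tab long (occurs-shift tab)

  shift-injective : ∀ {m S T} → Tableau μ m S × Long S → Tableau μ m T × Long T → shift S ≡ shift T → S ≡ T
  shift-injective {S = S} {T} (tabS , _) (tabT , _) eq = begin
    S                             ≡⟨ sym (lower-lift (suc (second S)) S) ⟩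
    lower (suc (second S)) (shift S) ≡⟨ cong₂ (λ b → lower (suc b)) same-second eq ⟩
    lower (suc (second T)) (shift T) ≡⟨ lower-lift (suc (second T)) T ⟩
    T                             ∎
    where
    open ≡-Reasoning
    same-second : second S ≡ second T
    same-second = ℕ.suc-injective (trans (sym (second-mapOffStem suc (second S) tabS))
      (trans (cong second eq) (second-mapOffStem suc (second T) tabT)))

  -- The preimage keeps the stem 0, ..., b-1 and lowers everything else. Shortness of T is exactly
  -- the maximality of the stem that `lower-tableau` asks for.
  shift-surjective : ∀ {m T} → Tableau μ (suc m) T × ¬ Long T → ∃ λ S → (Tableau μ m S × Long S) × shift S ≡ T
  shift-surjective {m} {T} (tab , short) with j , eq ← short-second-pos tab short =
    lower (suc j) T ,
    (lower-tableau j tab st (subst (λ b → ¬ Stem 0 (suc b) T) eq short) off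
       (subst (ℕ._≤ m) eq (ℕ.≤-pred (second-bounded tab))) ,
     subst (λ b → Stem 0 (suc b) (lower (suc j) T)) (sym second-lower) (mapOffStem-stem pred 0 (suc j) T st)) ,
    trans (cong (λ b → lift (suc b) (lower (suc j) T)) second-lower)
      (lift-lower (suc j) {T} (offStem-map (ℕ.≤-trans (s≤s z≤n)) (suc j) {T} off))
    where
    st : Stem 0 (suc j) T
    st = subst (λ b → Stem 0 b T) eq (stem-second tab)
    off = off-stem 0 j T st (columns tab) (subst (λ b → All (All (b ℕ.≤_) ∘ drop 1) T) eq (second-least tab))
    second-lower : second (lower (suc j) T) ≡ j
    second-lower = trans (second-mapOffStem pred j tab) (cong pred eq)

  -- Long tableaux with m values match short ones with m+1, so N(m) = short(m+1) + short(m). The sum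
  -- telescopes to short(n+1), which is 0 because n cells cannot hold n+1 different values.
  alternating-wide : (N : ℕ → ℕ) → (∀ m → Card (Tableau μ m) (N m)) → alternating (λ m → fromℕ (N m)) n ≡ 0ℚ
  alternating-wide N N# = begin
    alternating (λ m → fromℕ (N m)) n                        ≡⟨ alternating-cong split n ⟩
    alternating (λ m → fromℕ (short (suc m)) + fromℕ (short m)) n
      ≡⟨ alternating-telescope (λ m → fromℕ (short m)) (cong fromℕ no-values) n ⟩
    fromℕ (short (suc n))                                    ≡⟨ cong fromℕ too-many-values ⟩
    0ℚ                                                       ∎
    where
    open ≡-Reasoning
    short : ℕ → ℕ
    short m = count (¬? ∘ long?) (elements (N# m))
    short# : ∀ m → Card (λ T → Tableau μ m T × ¬ Long T) (short m)
    short# m = card-filter (N# m) (¬? ∘ long?)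
    long# : ∀ m → Card (λ T → Tableau μ m T × Long T) (count long? (elements (N# m)))
    long# m = card-filter (N# m) long?
    split : ∀ m → fromℕ (N m) ≡ fromℕ (short (suc m)) + fromℕ (short m)
    split m = trans
      (cong fromℕ (trans (card-split long? (N# m) (long# m) (short# m))
        (cong (ℕ._+ short m) (card-unique (card-map (long# m) shift shift-tableau shift-injective shift-surjective) (short# (suc m))))))
      (fromℕ-+ (short (suc m)) (short m))
    no-values : short 0 ≡ 0
    no-values = card-empty (short# 0) (λ (tab , _) → ℕ.n≮0 (second-bounded tab))
    too-many-values : short (suc n) ≡ 0
    too-many-values = card-empty (short# (suc n)) (λ {T} (tab , _) →
      ℕ.<-irrefl refl (subst (suc n ℕ.≤_) (cong sum (shape tab)) (occurs⇒≤ {T = T} (onto tab))))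

-- The pairing of the Schur functions

fillings-unique : ∀ k μ → Unique (fillings k μ)
fillings-unique k μ = choices-unique (All.map⁺ (All.universal (words-unique (Unique.allFin⁺ k)) μ))

∈-fillings⁺ : ∀ {k} (T : List (List (Fin k))) → T ∈ fillings k (map length T)
∈-fillings⁺ T = ∈-choices⁺ (rows∈ T)
  where
  rows∈ : ∀ T → Pointwise _∈_ T (map (words (allFin _)) (map length T))
  rows∈ []      = []
  rows∈ (r ∷ R) = ∈-words⁺ (All.universal ∈-allFin r) ∷ rows∈ R

∈-fillings⁻ : ∀ {k μ} {T : List (List (Fin k))} → T ∈ fillings k μ → map length T ≡ μ
∈-fillings⁻ {μ = μ} T∈ = lengths μ (∈-choices⁻ _ T∈)
  where
  lengths : ∀ μ {T} → Pointwise _∈_ T (map (words (allFin _)) μ) → map length T ≡ μ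
  lengths []      []       = refl
  lengths (l ∷ μ) (r∈ ∷ R∈) = cong₂ _∷_ (proj₁ (∈-words⁻ l r∈)) (lengths μ R∈)

values : ∀ {k} → List (List (Fin k)) → Filling
values = map (map toℕ)

values-injective : ∀ {k} {S T : List (List (Fin k))} → values S ≡ values T → S ≡ T
values-injective = List.map-injective (List.map-injective Fin.toℕ-injective)

values-shape : ∀ {k} (T : List (List (Fin k))) → map length (values T) ≡ map length T
values-shape []      = refl
values-shape (r ∷ R) = cong₂ _∷_ (List.length-map toℕ r) (values-shape R)

values-surjective : ∀ {k} {T : Filling} → All (All (ℕ._< k)) T → ∃ λ (S : List (List (Fin k))) → values S ≡ T
values-surjective []       = [] , refl
values-surjective (p ∷ ps) = let r , eq = row p ; R , eqs = values-surjective ps in r ∷ R , cong₂ _∷_ eq eqs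
  where
  row : ∀ {k r} → All (ℕ._< k) r → ∃ λ (r′ : List (Fin k)) → map toℕ r′ ≡ r
  row []       = [] , refl
  row (p ∷ ps) = let r , eq = row ps in fromℕ< p ∷ r , cong₂ _∷_ (Fin.toℕ-fromℕ< p) eq

#tableaux : List ℕ → ℕ → ℕ
#tableaux μ m = count (λ T → semistandard? T ×-dec (content (concat T) ∈? exponents (sum μ) m)) (fillings m μ)
  where open DecMembership _≟ᵉ_ using (_∈?_)

card-tableaux : ∀ μ m → Card (Tableau μ m) (#tableaux μ m)
card-tableaux μ m = card-image _ values (fillings m μ) (Unique.map⁺ values-injective (fillings-unique m μ))
  (λ {T} T∈ (ss , content∈) → sound′ T (∈-fillings⁻ T∈) ss content∈) exhaustive′
  where
  sound′ : ∀ T → map length T ≡ μ → Semistandard T → content (concat T) ∈ exponents (sum μ) m → Tableau μ m (values T)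
  sound′ T eq (rs , cs) content∈ = record
    { shape   = trans (values-shape T) eq
    ; bounded = All.map⁺ (All.universal (λ r → All.map⁺ (All.universal Fin.toℕ<n r)) T)
    ; rows    = All.map⁺ (All.map Linked.map⁺ rs)
    ; columns = Linked.map⁺ (Linked.map (Prefix.map⁺ toℕ toℕ) cs)
    ; onto    = λ {v} v<m → subst (λ v → Occurs v (values T)) (Fin.toℕ-fromℕ< v<m)
        (Any.map⁺ (Any.map (∈-map⁺ toℕ) (∈-concat⁻ T (content∈exponents⁻ {w = concat T} content∈ (fromℕ< v<m)))))
    }
  exhaustive′ : ∀ {T} → Tableau μ m T → ∃ λ S →
    S ∈ fillings m μ × (Semistandard S × content (concat S) ∈ exponents (sum μ) m) × values S ≡ T
  exhaustive′ tab with S , refl ← values-surjective (bounded tab) =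
    S , subst (λ μ → S ∈ fillings m μ) shapeS (∈-fillings⁺ S) ,
    ((All.map Linked.map⁻ (All.map⁻ (rows tab)) , Linked.map (Prefix.map⁻ toℕ toℕ) (Linked.map⁻ (columns tab))) ,
     content∈exponents⁺ (trans (length-concat S) (cong sum shapeS)) occurs) , refl
    where
    shapeS = trans (sym (values-shape S)) (shape tab)
    occurs : ∀ i → i ∈ concat S
    occurs i = ∈-concat⁺ (Any.map back (Any.map⁻ (onto tab (Fin.toℕ<n i))))
      where
      back : ∀ {r} → toℕ i ∈ map toℕ r → i ∈ r
      back {r} i∈ with j , j∈ , eq ← ∈-map⁻ toℕ i∈ = subst (_∈ r) (sym (Fin.toℕ-injective eq)) j∈

pairing-s : ∀ μ → ⟨ s μ ,e sum μ ⟩ ≡ alternating (λ m → fromℕ (#tableaux μ m)) (sum μ)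
pairing-s μ = pairing-count (sum μ) semistandard? (content ∘ concat) (λ m → fillings m μ)

pairing-s-wide : ∀ {μ l μs} → μ ≡ suc (suc l) ∷ μs → ⟨ s μ ,e sum μ ⟩ ≡ 0ℚ
pairing-s-wide {μ} μ-wide = trans (pairing-s μ) (alternating-wide μ-wide (#tableaux μ) (card-tableaux μ))

column : ℕ → Filling
column n = map (_∷ []) (upTo n)

column-tableau : ∀ n → Tableau (1^ n) n (column n)
column-tableau n = record
  { shape   = trans (shapes (upTo n)) (cong 1^ (List.length-upTo n))
  ; bounded = All.map⁺ (All.tabulate (λ v∈ → ∈-upTo⁻ v∈ ∷ []))
  ; rows    = All.map⁺ (All.universal (λ _ → [-]) (upTo n))
  ; columns = Linked.map⁺ (Linked.map (_∷ []) (Linked.applyUpTo⁺₂ id n ℕ.n<1+n))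
  ; onto    = λ v<n → Any.map⁺ (Any.map here (∈-upTo⁺ v<n))
  }
  where
  shapes : ∀ xs → map length (map (_∷ []) xs) ≡ 1^ (length xs)
  shapes []       = refl
  shapes (x ∷ xs) = cong (1 ∷_) (shapes xs)

column-bound : ∀ {n c m T} → map length T ≡ 1^ (suc n) → All (All (c ℕ.≤_)) T → All (All (ℕ._< m)) T →
  ColumnsIncrease T → c ℕ.+ n ℕ.< m
column-bound {zero} {c} {m} {(a ∷ []) ∷ []} _ ((c≤a ∷ []) ∷ []) ((a<m ∷ []) ∷ []) _ =
  subst (ℕ._< m) (sym (ℕ.+-identityʳ c)) (ℕ.≤-<-trans c≤a a<m)
column-bound {suc n} {c} {m} {(a ∷ []) ∷ R} eq (c≤a ∷ _) (_ ∷ bd) cols =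
  subst (ℕ._< m) (sym (ℕ.+-suc c n))
    (column-bound {n} {suc c} {T = R} (List.∷-injectiveʳ eq) (below c≤a cols) bd (Linked.tail cols))

sum-1^ : ∀ n → sum (1^ n) ≡ n
sum-1^ zero    = refl
sum-1^ (suc n) = cong suc (sum-1^ n)

-- A column of n cells needs n distinct values, so only the term m = n survives, and its sign is
-- positive.
pairing-s-column : ∀ n → 0ℚ ℚ.< ⟨ s (1^ n) ,e n ⟩
pairing-s-column n = subst (0ℚ ℚ.<_) (sym equality) (fromℕ-pos (card-nonempty (card-tableaux (1^ n) n) (column-tableau n)))
  where
  too-few-values : ∀ n {m} → m ℕ.< n → #tableaux (1^ n) m ≡ 0
  too-few-values (suc n) {m} m<1+n = card-empty (card-tableaux (1^ (suc n)) m) λ {T} tab →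
    ℕ.<⇒≱ (column-bound {n} {0} {m} {T} (shape tab) (All.universal (All.universal (λ _ → z≤n)) T) (bounded tab) (columns tab))
      (ℕ.≤-pred m<1+n)
  f : ℕ → ℚ
  f m = fromℕ (#tableaux (1^ n) m)
  f≡0 : ∀ {m} → m ℕ.< n → f m ≡ 0ℚ
  f≡0 m<n = cong fromℕ (too-few-values n m<n)
  equality : ⟨ s (1^ n) ,e n ⟩ ≡ fromℕ (#tableaux (1^ n) n)
  equality = trans (subst (λ m → ⟨ s (1^ n) ,e m ⟩ ≡ alternating f m) (sum-1^ n) (pairing-s (1^ n)))
    (alternating-vanishing {f} {n} f≡0)

-- Square-free monomials

⊆-reverse : ∀ {k} {xs ys : List (Fin k)} → Unique xs → (∀ {x} → x ∈ xs → x ∈ ys) → length ys ℕ.≤ length xs →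
  ∀ {y} → y ∈ ys → y ∈ xs
⊆-reverse {xs = xs} {ys} xs! xs⊆ys ys≤xs {y} y∈ys with DecMembership._∈?_ Fin._≟_ y xs
... | yes y∈xs = y∈xs
... | no y∉xs  = contradiction (ℕ.≤-trans (length-⊆ {xs = y ∷ xs} (All.¬Any⇒All¬ xs y∉xs ∷ xs!)
    λ { (here refl) → y∈ys ; (there x∈xs) → xs⊆ys x∈xs }) ys≤xs) (ℕ.<-irrefl refl)

content-⊆ : ∀ {k} {v w : List (Fin k)} → Unique v → Unique w → (∀ {x} → x ∈ v → x ∈ w) →
  (∀ {x} → x ∈ w → x ∈ v) → content v ≡ content w
content-⊆ {v = v} {w} v! w! v⊆w w⊆v = Vec.tabulate-cong λ i → ℕ.≤-antisym
  (length-⊆ (Unique.filter⁺ (i Fin.≟_) v!) (filter-⊆ i v⊆w)) (length-⊆ (Unique.filter⁺ (i Fin.≟_) w!) (filter-⊆ i w⊆v))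
  where
  filter-⊆ : ∀ {v w} i → (∀ {x} → x ∈ v → x ∈ w) → ∀ {x} → x ∈ filter (i Fin.≟_) v → x ∈ filter (i Fin.≟_) w
  filter-⊆ i v⊆w x∈ = let x∈v , i≡x = ∈-filter⁻ (i Fin.≟_) x∈ in ∈-filter⁺ (i Fin.≟_) (v⊆w x∈v) i≡x

support : ∀ {k} → Vec ℕ k → List (Fin k)
support α = filter (λ i → lookup α i ℕ.≟ 1) (allFin _)

∈-support⁺ : ∀ {k} {w : List (Fin k)} → Unique w → ∀ {i} → i ∈ w → i ∈ support (content w)
∈-support⁺ {w = w} w! {i} i∈w = ∈-filter⁺ (λ i → lookup (content w) i ℕ.≟ 1) (∈-allFin i)
  (trans (Vec.lookup∘tabulate _ i) (ℕ.≤-antisym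
    (length-⊆ {ys = i ∷ []} (Unique.filter⁺ (i Fin.≟_) w!) λ j∈ → here (sym (proj₂ (∈-filter⁻ (i Fin.≟_) {xs = w} j∈))))
    (∈-length (∈-filter⁺ (i Fin.≟_) i∈w refl))))

∈-support⁻ : ∀ {k} {w : List (Fin k)} {i} → i ∈ support (content w) → i ∈ w
∈-support⁻ {w = w} i∈ = ∈-content (ℕ.≤-reflexive (sym
  (proj₂ (∈-filter⁻ (λ i → lookup (content w) i ℕ.≟ 1) {xs = allFin _} i∈))))

support-unique : ∀ {k} (α : Vec ℕ k) → Unique (support α)
support-unique α = Unique.filter⁺ (λ i → lookup α i ℕ.≟ 1) (Unique.allFin⁺ _)

-- These are the 0/1 vectors with n ones. Going through `support` makes the condition decidable and
-- presents α as the content of a concrete increasing list.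
SquareFree : ∀ {k} → ℕ → Vec ℕ k → Set
SquareFree n α = length (support α) ≡ n × content (support α) ≡ α

squareFree? : ∀ {k} n (α : Vec ℕ k) → Dec (SquareFree n α)
squareFree? n α = (length (support α) ℕ.≟ n) ×-dec (content (support α) ≟ᵉ α)

unique⇒squareFree : ∀ {k} {w : List (Fin k)} → Unique w → SquareFree (length w) (content w)
unique⇒squareFree {w = w} w! =
  ℕ.≤-antisym (length-⊆ (support-unique (content w)) (∈-support⁻ {w = w})) (length-⊆ w! (∈-support⁺ w!)) ,
  content-⊆ (support-unique (content w)) w! ∈-support⁻ (∈-support⁺ w!)

sorted-≡ : ∀ {k} {v w : List (Fin k)} → AllPairs Fin._<_ v → AllPairs Fin._<_ w →
  (∀ {x} → x ∈ v → x ∈ w) → (∀ {x} → x ∈ w → x ∈ v) → v ≡ w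
sorted-≡ {v = []}     {[]}     _ _ _ _ = refl
sorted-≡ {v = []}     {y ∷ w} _ _ _ w⊆v with () ← w⊆v (here refl)
sorted-≡ {v = x ∷ v} {[]}     _ _ v⊆w _ with () ← v⊆w (here refl)
sorted-≡ {v = x ∷ v} {y ∷ w} (x<v ∷ v↑) (y<w ∷ w↑) v⊆w w⊆v = heads (v⊆w (here refl)) (w⊆v (here refl))
  where
  tails′ : ∀ {x v w} → All (x Fin.<_) v → (∀ {z} → z ∈ x ∷ v → z ∈ x ∷ w) → ∀ {z} → z ∈ v → z ∈ w
  tails′ x<v v⊆w z∈v with v⊆w (there z∈v)
  ... | here refl = contradiction (All.lookup x<v z∈v) (ℕ.<-irrefl refl)
  ... | there z∈w = z∈w
  heads : x ∈ y ∷ w → y ∈ x ∷ v → x ∷ v ≡ y ∷ w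
  heads (here refl)  _            = cong (x ∷_) (sorted-≡ v↑ w↑ (tails′ x<v v⊆w) (tails′ y<w w⊆v))
  heads (there _)    (here refl)  = cong (x ∷_) (sorted-≡ v↑ w↑ (tails′ x<v v⊆w) (tails′ y<w w⊆v))
  heads (there x∈w) (there y∈v) = contradiction (All.lookup y<w x∈w) (ℕ.<-asym (All.lookup x<v y∈v))

sorted⇒unique : ∀ {k} {w : List (Fin k)} → AllPairs Fin._<_ w → Unique w
sorted⇒unique = AllPairs.map (λ { x<x refl → ℕ.<-irrefl refl x<x })

support-sorted : ∀ {k} (α : Vec ℕ k) → AllPairs Fin._<_ (support α)
support-sorted {k} α = AllPairs.filter⁺ (λ i → lookup α i ℕ.≟ 1) (AllPairs.tabulate⁺-< id)

lookup-injective : ∀ {A : Set} {xs : List A} → Unique xs → ∀ {i j} → List.lookup xs i ≡ List.lookup xs j → i ≡ j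
lookup-injective (x∉xs ∷ xs!) {zero}  {zero}  eq = refl
lookup-injective (x∉xs ∷ xs!) {zero}  {suc j} eq = contradiction eq (All.lookup x∉xs (∈-lookup j))
lookup-injective (x∉xs ∷ xs!) {suc i} {zero}  eq = contradiction (sym eq) (All.lookup x∉xs (∈-lookup i))
lookup-injective (x∉xs ∷ xs!) {suc i} {suc j} eq = cong suc (lookup-injective xs! eq)

-- The complete graph

Inj : ∀ {n k} → Vec (Fin k) n → Set
Inj {n} v = Proper (complete n) (lookup v)

inj⇒injective : ∀ {n k} {κ : Fin n → Fin k} → Proper (complete n) κ → ∀ {x y} → κ x ≡ κ y → x ≡ y
inj⇒injective proper {x} {y} eq with x Fin.≟ y
... | yes x≡y = x≡y
... | no x≢y  = contradiction eq (proper x y x≢y)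

-- This number is n!, as the injections of `Fin n` into itself are the permutations.
#injective : ℕ → ℕ
#injective n = count (λ (v : Vec (Fin n) n) → proper? (complete n) (lookup v)) (vectors n n)

card-injective : ∀ n → Card (Inj {n} {n}) (#injective n)
card-injective n = card-image (λ (v : Vec (Fin n) n) → proper? (complete n) (lookup v)) id (vectors n n)
  (subst Unique (sym (List.map-id (vectors n n))) (vectors-unique n n)) (λ _ p → p) (λ p → _ , ∈-vectors _ , p , refl)

#injective-pos : ∀ n → 0 ℕ.< #injective n
#injective-pos n = card-nonempty (card-injective n) {Vec.tabulate id}
  (λ x y x≢y → x≢y ∘ subst₂ _≡_ (Vec.lookup∘tabulate id x) (Vec.lookup∘tabulate id y))

word : ∀ {n k} → Vec (Fin k) n → List (Fin k)
word v = List.tabulate (lookup v)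

word-unique : ∀ {n k} {v : Vec (Fin k) n} → Inj v → Unique (word v)
word-unique {v = v} inj = Unique.tabulate⁺ (inj⇒injective {κ = lookup v} inj)

#colorings-complete : ∀ n {k} → Vec ℕ k → ℕ
#colorings-complete n {k} α =
  count (λ κ → proper? (complete n) κ ×-dec (content (List.tabulate κ) ≟ᵉ α)) (colorings n k)

card-colorings-complete : ∀ n {k} (α : Vec ℕ k) →
  Card (λ (v : Vec (Fin k) n) → Inj v × content (word v) ≡ α) (#colorings-complete n α)
card-colorings-complete n {k} α = card-image _ Vec.tabulate (colorings n k) (vectors-unique n k)
  (λ {κ} _ (proper , eq) → (λ x y x≢y → proper x y x≢y ∘ subst₂ _≡_ (Vec.lookup∘tabulate κ x) (Vec.lookup∘tabulate κ y)) ,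
    trans (cong content (List.tabulate-cong (Vec.lookup∘tabulate κ))) eq)
  λ {v} (proper , eq) → let κ , κ∈ , κ≗v = coloring v in κ , κ∈ ,
    ((λ x y x≢y → proper x y x≢y ∘ subst₂ _≡_ (κ≗v x) (κ≗v y)) ,
     trans (cong content (List.tabulate-cong κ≗v)) eq) , tabulate-lookup κ≗v

-- Composing with the list `support α` turns injections of `Fin n` into itself into the colorings of
-- content α. Matching on `refl` makes n the length of that list, so `Fin n` indexes it.
card-colorings-squareFree : ∀ n {k} (α : Vec ℕ k) → SquareFree n α →
  Card (λ (v : Vec (Fin k) n) → Inj v × content (word v) ≡ α) (#injective n)
card-colorings-squareFree _ {k} α (refl , content≡) = card-map (card-injective n) paint (λ {v} → paint-sound {v})
  (λ {v} {w} _ _ → paint-injective v w) paint-surjective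
  where
  c = support α
  c! = support-unique α
  n = length c
  paint : Vec (Fin n) n → Vec (Fin k) n
  paint = Vec.map (List.lookup c)
  lookup-paint : ∀ v x → lookup (paint v) x ≡ List.lookup c (lookup v x)
  lookup-paint v x = Vec.lookup-map x (List.lookup c) v
  paint-inj : ∀ {v} → Inj v → Inj (paint v)
  paint-inj {v} inj x y x≢y = inj x y x≢y ∘ lookup-injective c! ∘ subst₂ _≡_ (lookup-paint v x) (lookup-paint v y)
  paint-⊆ : ∀ v {i} → i ∈ word (paint v) → i ∈ c
  paint-⊆ v i∈ with x , refl ← ∈-tabulate⁻ {f = lookup (paint v)} i∈ =
    subst (_∈ c) (sym (lookup-paint v x)) (∈-lookup (lookup v x))
  paint-sound : ∀ {v} → Inj v → Inj (paint v) × content (word (paint v)) ≡ α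
  -- The n distinct letters of the painted word all lie in the n-letter support, so they exhaust it
  -- and the contents agree.
  paint-sound {v} inj = paint-inj {v} inj , trans (content-⊆ w! c! (paint-⊆ v)
    (⊆-reverse w! (paint-⊆ v) (ℕ.≤-reflexive (sym (List.length-tabulate (lookup (paint v))))))) content≡
    where w! = word-unique {v = paint v} (paint-inj {v} inj)
  paint-injective : ∀ v w → paint v ≡ paint w → v ≡ w
  paint-injective v w eq = trans (sym (Vec.tabulate∘lookup v)) (tabulate-lookup λ x → lookup-injective c!
    (trans (sym (lookup-paint v x)) (trans (cong (λ u → lookup u x) eq) (lookup-paint w x))))
  paint-surjective : ∀ {w} → Inj w × content (word w) ≡ α → ∃ λ v → Inj v × paint v ≡ w
  paint-surjective {w} (inj , eq) = v ,
    (λ x y x≢y vx≡vy → inj x y x≢y (trans (sym (lookup-v x)) (trans (cong (List.lookup c) vx≡vy) (lookup-v y)))) ,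
    trans (sym (Vec.tabulate∘lookup (paint v))) (tabulate-lookup λ x → trans (lookup-paint v x) (lookup-v x))
    where
    w∈c : ∀ x → lookup w x ∈ c
    w∈c x = subst (λ α → lookup w x ∈ support α) eq (∈-support⁺ (word-unique {v = w} inj) (∈-tabulate⁺ x))
    v = Vec.tabulate (Any.index ∘ w∈c)
    lookup-v : ∀ x → List.lookup c (lookup v x) ≡ lookup w x
    lookup-v x = trans (cong (List.lookup c) (Vec.lookup∘tabulate (Any.index ∘ w∈c) x)) (sym (Any.lookup-index (w∈c x)))

#columns : ∀ n {k} → Vec ℕ k → ℕ
#columns n {k} α = count (λ T → semistandard? T ×-dec (content (concat T) ≟ᵉ α)) (fillings k (1^ n))

ColumnOf : ∀ n {k} → Vec ℕ k → List (List (Fin k)) → Set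
ColumnOf n α T = map length T ≡ 1^ n × Semistandard T × content (concat T) ≡ α

card-columns : ∀ n {k} (α : Vec ℕ k) → Card (ColumnOf n α) (#columns n α)
card-columns n {k} α = card-image _ id (fillings k (1^ n))
  (subst Unique (sym (List.map-id (fillings k (1^ n)))) (fillings-unique k (1^ n)))
  (λ T∈ p → ∈-fillings⁻ T∈ , p)
  (λ {T} (eq , p) → T , subst (λ μ → T ∈ fillings k μ) eq (∈-fillings⁺ T) , p , refl)

singletons : ∀ {k} → List (Fin k) → List (List (Fin k))
singletons = map (_∷ [])

column-singletons : ∀ {k} n {T : List (List (Fin k))} → map length T ≡ 1^ n →
  T ≡ singletons (concat T) × length (concat T) ≡ n
column-singletons zero    {[]}           eq = refl , refl
column-singletons (suc n) {(x ∷ []) ∷ T} eq =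
  let eq₁ , eq₂ = column-singletons n {T} (List.∷-injectiveʳ eq) in cong ((x ∷ []) ∷_) eq₁ , cong suc eq₂

singletons-sorted : ∀ {k} {w : List (Fin k)} → Semistandard (singletons w) → AllPairs Fin._<_ w
singletons-sorted (_ , cols) = Linked.Linked⇒AllPairs (λ {i} {j} {l} → Fin.<-trans {i = i} {j} {l})
  (Linked.map (λ { (x<y ∷ _) → x<y }) (Linked.map⁻ cols))

singletons-semistandard : ∀ {k} {w : List (Fin k)} → AllPairs Fin._<_ w → Semistandard (singletons w)
singletons-semistandard {w = w} sorted = All.map⁺ (All.universal (λ _ → [-]) w) ,
  Linked.map⁺ (Linked.map (_∷ []) (Linked.AllPairs⇒Linked sorted))

column-sorted : ∀ {k} n {α : Vec ℕ k} {T} → ColumnOf n α T → AllPairs Fin._<_ (concat T)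
column-sorted n (shape , ss , _) = singletons-sorted (subst Semistandard (proj₁ (column-singletons n shape)) ss)

card-columns-squareFree : ∀ n {k} (α : Vec ℕ k) → SquareFree n α → Card (ColumnOf n α) 1
card-columns-squareFree n α (length≡ , content≡) = record
  { elements   = singletons c ∷ []
  ; unique     = [] ∷ []
  ; sound      = λ { (here refl) → trans (singletons-shape c) (cong 1^ length≡) , singletons-semistandard (support-sorted α) ,
                     trans (cong content (List.concat-map-[ c ])) content≡ }
  ; exhaustive = λ {T} col → here (trans (proj₁ (column-singletons n (proj₁ col))) (cong singletons (column≡ T col)))
  ; size       = refl
  }
  where
  c = support α
  singletons-shape : ∀ w → map length (singletons w) ≡ 1^ (length w)
  singletons-shape []      = refl
  singletons-shape (x ∷ w) = cong (1 ∷_) (singletons-shape w)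
  column≡ : ∀ T → ColumnOf n α T → concat T ≡ c
  column≡ T col@(_ , _ , refl) = sorted-≡ sorted (support-sorted α) (∈-support⁺ (sorted⇒unique sorted)) ∈-support⁻
    where sorted = column-sorted n col

-- This is X_{K_n} = n! eₙ. Vertices of K_n have distinct colors and a column has distinct entries,
-- so both sides vanish unless α is square-free of degree n. At such α there are n! colorings, and
-- one column, since an increasing column is determined by its set of entries.
X-complete : ∀ n → X (complete n) ≈ (fromℕ (#injective n) · s (1^ n))
X-complete n {k} α = by-cases (squareFree? n α)
  where
  open ≡-Reasoning
  by-cases : Dec (SquareFree n α) → fromℕ (#colorings-complete n α) ≡ fromℕ (#injective n) * fromℕ (#columns n α)
  by-cases (yes sf) = begin
    fromℕ (#colorings-complete n α)
      ≡⟨ cong fromℕ (card-unique (card-colorings-complete n α) (card-colorings-squareFree n α sf)) ⟩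
    fromℕ (#injective n)              ≡⟨ sym (ℚ.*-identityʳ (fromℕ (#injective n))) ⟩
    fromℕ (#injective n) * 1ℚ
      ≡⟨ cong (λ m → fromℕ (#injective n) * fromℕ m) (card-unique (card-columns-squareFree n α sf) (card-columns n α)) ⟩
    fromℕ (#injective n) * fromℕ (#columns n α) ∎
  by-cases (no ¬sf) = begin
    fromℕ (#colorings-complete n α)
      ≡⟨ cong fromℕ (card-empty (card-colorings-complete n α) λ {v} (inj , eq) → ¬sf (subst₂ SquareFree
           (List.length-tabulate (lookup v)) eq (unique⇒squareFree (word-unique {v = v} inj)))) ⟩
    0ℚ                                ≡⟨ sym (ℚ.*-zeroʳ (fromℕ (#injective n))) ⟩
    fromℕ (#injective n) * 0ℚ
      ≡⟨ cong (λ m → fromℕ (#injective n) * fromℕ m) (sym (card-empty (card-columns n α) λ {T} col → ¬sf (subst₂ SquareFree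
           (proj₂ (column-singletons n (proj₁ col))) (proj₂ (proj₂ col)) (unique⇒squareFree (sorted⇒unique (column-sorted n col)))))) ⟩
    fromℕ (#injective n) * fromℕ (#columns n α) ∎

-- The list of partitions

partitions-unique : ∀ n → Unique (partitions n)
partitions-unique n = Unique.filter⁺ (_⊢? n) (Unique.concat⁺
  (All.map⁺ (All.universal (words-unique (Unique.upTo⁺ (suc n))) (upTo (suc n))))
  (AllPairs.map⁺ (AllPairs.map disjoint (Unique.upTo⁺ (suc n)))))
  where
  disjoint : ∀ {i j} → i ≢ j → Disjoint (words (upTo (suc n)) i) (words (upTo (suc n)) j)
  disjoint {i} {j} i≢j (w∈i , w∈j) = i≢j (trans (sym (proj₁ (∈-words⁻ i w∈i))) (proj₁ (∈-words⁻ j w∈j)))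

∈-partitions⁻ : ∀ {n μ} → μ ∈ partitions n → μ ⊢ n
∈-partitions⁻ {n} μ∈ = proj₂ (∈-filter⁻ (_⊢? n) {xs = concatMap (words (upTo (suc n))) (upTo (suc n))} μ∈)

1^⊢ : ∀ n → 1^ n ⊢ n
1^⊢ n = linked n , All.replicate⁺ n (s≤s z≤n) , sum-1^ n
  where
  linked : ∀ n → Linked ℕ._≥_ (1^ n)
  linked zero          = []
  linked (suc zero)    = [-]
  linked (suc (suc n)) = ℕ.≤-refl ∷ linked (suc n)

1^∈partitions : ∀ n → 1^ n ∈ partitions n
1^∈partitions zero    = here refl
1^∈partitions (suc n) = ∈-filter⁺ (_⊢? suc n) (∈-concat⁺′ (subst (λ m → 1^ (suc n) ∈ words (upTo (2 ℕ.+ n)) m)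
    (List.length-replicate (suc n)) (∈-words⁺ (All.replicate⁺ (suc n) (∈-upTo⁺ (s≤s (s≤s z≤n))))))
  (∈-map⁺ (words (upTo (2 ℕ.+ n))) (∈-upTo⁺ (ℕ.n<1+n (suc n))))) (1^⊢ (suc n))

-- Parts are positive and weakly decreasing, so a first part 1 forces all parts to be 1. Every other
-- nonempty shape has the two cells in its first row on which the involution relies.
1^-or-wide : ∀ {n μ} → μ ⊢ n → μ ≡ 1^ n ⊎ ∃₂ λ l μs → μ ≡ suc (suc l) ∷ μs
1^-or-wide {μ = []}              (_ , _ , refl)         = inj₁ refl
1^-or-wide {μ = zero ∷ μs}       (_ , () ∷ _ , _)
1^-or-wide {μ = suc (suc l) ∷ μs} _                     = inj₂ (l , μs , refl)
1^-or-wide {μ = suc zero ∷ μs}   (linked , pos , refl)  = inj₁ (trans ones (cong 1^ (sym (trans (cong sum ones) (sum-1^ _)))))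
  where
  all-ones : ∀ {μ} → Linked ℕ._≥_ (1 ∷ μ) → All (0 ℕ.<_) μ → 1 ∷ μ ≡ 1^ (suc (length μ))
  all-ones [-]                []            = refl
  all-ones (s≤s z≤n ∷ linked) (s≤s z≤n ∷ pos) = cong (1 ∷_) (all-ones linked pos)
  ones : 1 ∷ μs ≡ 1^ (suc (length μs))
  ones = all-ones linked (All.tail pos)

-- Schur coefficients

pairing-s-other : ∀ {n μ} → μ ⊢ n → μ ≢ 1^ n → ⟨ s μ ,e n ⟩ ≡ 0ℚ
pairing-s-other {μ = μ} μ⊢n μ≢1^n = subst (λ n → ⟨ s μ ,e n ⟩ ≡ 0ℚ) (proj₂ (proj₂ μ⊢n))
  (pairing-s-wide (proj₂ (proj₂ wide-shape)))
  where
  wide-shape : ∃₂ λ l μs → μ ≡ suc (suc l) ∷ μs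
  wide-shape with 1^-or-wide μ⊢n
  ... | inj₁ μ≡1^n = contradiction μ≡1^n μ≢1^n
  ... | inj₂ shape = shape

∑-partitions : ∀ n (f : List ℕ → ℚ) → (∀ {μ} → μ ⊢ n → μ ≢ 1^ n → f μ ≡ 0ℚ) → ∑ f (partitions n) ≡ f (1^ n)
∑-partitions n f f≡0 = ∑-single (partitions-unique n) (1^∈partitions n) (λ μ∈ → f≡0 (∈-partitions⁻ μ∈))

pairing-expansion : ∀ {n} {F : Series} (E : SchurExpansion n F) → ⟨ F ,e n ⟩ ≡ coeff E (1^ n) * ⟨ s (1^ n) ,e n ⟩
pairing-expansion {n} {F} E = begin
  ⟨ F ,e n ⟩                                              ≡⟨ pairing-cong {n} {F} {∑s n (coeff E)} (expands E) ⟩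
  ⟨ ∑s n (coeff E) ,e n ⟩                                 ≡⟨ pairing-∑ n (coeff E) (partitions n) ⟩
  ∑ (λ μ → coeff E μ * ⟨ s μ ,e n ⟩) (partitions n)
    ≡⟨ ∑-partitions n _ (λ {μ} μ⊢n μ≢1^n →
         trans (cong (coeff E μ *_) (pairing-s-other μ⊢n μ≢1^n)) (ℚ.*-zeroʳ (coeff E μ))) ⟩
  coeff E (1^ n) * ⟨ s (1^ n) ,e n ⟩                      ∎
  where open ≡-Reasoning

coeff-1^-nonNeg : ∀ {n} (G : Graph n) (E : SchurExpansion n (X G)) → 0ℚ ≤ coeff E (1^ n)
coeff-1^-nonNeg {n} G E = ℚ.*-cancelʳ-≤-pos t {{ℚ.positive (pairing-s-column n)}}
  (subst₂ _≤_ (sym (ℚ.*-zeroˡ t)) (pairing-expansion {F = X G} E) (pairing-X-nonNeg G))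
  where t = ⟨ s (1^ n) ,e n ⟩

completeCoeff : ℕ → List ℕ → ℚ
completeCoeff n μ = if does (List.≡-dec ℕ._≟_ μ (1^ n)) then fromℕ (#injective n) else 0ℚ

completeCoeff-1^ : ∀ n → completeCoeff n (1^ n) ≡ fromℕ (#injective n)
completeCoeff-1^ n = cong (if_then fromℕ (#injective n) else 0ℚ) (dec-true (List.≡-dec ℕ._≟_ (1^ n) (1^ n)) refl)

completeCoeff-other : ∀ {n μ} → μ ≢ 1^ n → completeCoeff n μ ≡ 0ℚ
completeCoeff-other {n} {μ} μ≢1^n =
  cong (if_then fromℕ (#injective n) else 0ℚ) (dec-false (List.≡-dec ℕ._≟_ μ (1^ n)) μ≢1^n)

completeCoeff-nonNeg : ∀ n μ → 0ℚ ≤ completeCoeff n μ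
completeCoeff-nonNeg n μ = if-nonNeg (does (List.≡-dec ℕ._≟_ μ (1^ n))) (fromℕ-nonNeg (#injective n))
  where
  if-nonNeg : ∀ b {q} → 0ℚ ≤ q → 0ℚ ≤ (if b then q else 0ℚ)
  if-nonNeg true  0≤q = 0≤q
  if-nonNeg false _   = ℚ.≤-refl

complete-expansion : ∀ n → SchurExpansion n (X (complete n))
complete-expansion n = record { coeff = completeCoeff n ; expands = expands′ }
  where
  expands′ : X (complete n) ≈ ∑s n (completeCoeff n)
  expands′ α = trans (X-complete n α) (trans (cong (_* s (1^ n) α) (sym (completeCoeff-1^ n)))
    (sym (∑-partitions n (λ μ → completeCoeff n μ * s μ α)
      (λ {μ} _ μ≢1^n → trans (cong (_* s μ α) (completeCoeff-other μ≢1^n)) (ℚ.*-zeroˡ (s μ α))))))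

expansion-+· : ∀ {n} {F H : Series} → SchurExpansion n F → SchurExpansion n H → ∀ r →
  SchurExpansion n (λ α → F α + r * H α)
expansion-+· {n} {F} {H} E E′ r = record { coeff = λ μ → coeff E μ + r * coeff E′ μ ; expands = expands′ }
  where
  distrib : ∀ a b c r → (a + r * b) * c ≡ a * c + r * (b * c)
  distrib = solve 4 (λ a b c r → (a :+ r :* b) :* c := a :* c :+ r :* (b :* c)) refl
    where open +-*-Solver
  expands′ : (λ {k} (α : Vec ℕ k) → F α + r * H α) ≈ ∑s n (λ μ → coeff E μ + r * coeff E′ μ)
  expands′ α = begin
    F α + r * H α ≡⟨ cong₂ (λ x y → x + r * y) (expands E α) (expands E′ α) ⟩
    ∑ e (partitions n) + r * ∑ e′ (partitions n) ≡⟨ cong (∑ e (partitions n) +_) (sym (∑-* r e′ (partitions n))) ⟩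
    ∑ e (partitions n) + ∑ (λ μ → r * e′ μ) (partitions n) ≡⟨ sym (∑-+ e (λ μ → r * e′ μ) (partitions n)) ⟩
    ∑ (λ μ → e μ + r * e′ μ) (partitions n)
      ≡⟨ ∑-cong (λ μ → sym (distrib (coeff E μ) (coeff E′ μ) (s μ α) r)) (partitions n) ⟩
    ∑s n (λ μ → coeff E μ + r * coeff E′ μ) α ∎
    where
    open ≡-Reasoning
    e  = λ μ → coeff E μ * s μ α
    e′ = λ μ → coeff E′ μ * s μ α

expansion-resp-≈ : ∀ {n} {F H : Series} → F ≈ H → SchurExpansion n F → SchurExpansion n H
expansion-resp-≈ F≈H E = record { coeff = coeff E ; expands = λ α → trans (sym (F≈H α)) (expands E α) }

-- Division in ℚ and the two implications

*-nonNeg : ∀ {p q} → 0ℚ ≤ p → 0ℚ ≤ q → 0ℚ ≤ p * q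
*-nonNeg {p} {q} 0≤p 0≤q = subst (_≤ p * q) (ℚ.*-zeroʳ p) (ℚ.*-monoˡ-≤-nonNeg p {{ℚ.nonNegative 0≤p}} 0≤q)

÷-nonNeg : ∀ {p q} .{{_ : ℚ.NonZero q}} → 0ℚ ≤ p → 0ℚ ≤ q → 0ℚ ≤ p ÷ q
÷-nonNeg {p} {q} 0≤p 0≤q = *-nonNeg 0≤p (1/-nonNeg {{ℚ.nonNeg∧nonZero⇒pos q {{ℚ.nonNegative 0≤q}}}})
  where
  1/-nonNeg : {{_ : ℚ.Positive q}} → 0ℚ ≤ (1/ q) {{ℚ.pos⇒nonZero q}}
  1/-nonNeg = ℚ.<⇒≤ (ℚ.positive⁻¹ ((1/ q) {{ℚ.pos⇒nonZero q}}) {{ℚ.1/pos⇒pos q}})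

÷-* : ∀ p q .{{_ : ℚ.NonZero q}} → p ÷ q * q ≡ p
÷-* p q = trans (ℚ.*-assoc p (1/ q) q) (trans (cong (p *_) (ℚ.*-inverseˡ q)) (ℚ.*-identityʳ p))

≥ₛ-complete⇒positive : ∀ {n} (G : Graph n) → G ≥ₛ complete n → SchurPositive n (X G)
≥ₛ-complete⇒positive {n} G (EG , EK , nz , E , positive) =
  expansion-resp-≈ {F = λ α → Xₛ G (complete n) EG EK {{nz}} α + r * X (complete n) α} {H = X G}
    (λ α → cancel (X G α) (r * X (complete n) α))
    -- X_{K_n} is added back through `complete-expansion n` and not through the supplied `EK`: for
    -- `EK` the sign is established at 1ⁿ only, here it is needed at every partition. `EK` enters
    -- through the quotient r alone.
    (expansion-+· {F = Xₛ G (complete n) EG EK {{nz}}} {H = X (complete n)} E (complete-expansion n) r) ,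
  λ μ μ⊢n → +-nonNeg (positive μ μ⊢n) (*-nonNeg r≥0 (completeCoeff-nonNeg n μ))
  where
  r = (coeff EG (1^ n) ÷ coeff EK (1^ n)) {{nz}}
  r≥0 : 0ℚ ≤ r
  r≥0 = ÷-nonNeg {{nz}} (coeff-1^-nonNeg G EG) (coeff-1^-nonNeg (complete n) EK)
  cancel : ∀ a b → a - b + b ≡ a
  cancel = solve 2 (λ a b → a :- b :+ b := a) refl
    where open +-*-Solver

-- In this direction the expansions may be chosen. With the one of X_{K_n} concentrated at 1ⁿ, the
-- quotient r makes the coefficient of the difference at 1ⁿ exactly 0.
positive⇒≥ₛ-complete : ∀ {n} (G : Graph n) → SchurPositive n (X G) → G ≥ₛ complete n
positive⇒≥ₛ-complete {n} G (E , positive) = E , complete-expansion n , nz ,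
  expansion-resp-≈ {F = λ α → X G α + (- r) * X (complete n) α} {H = Xₛ G (complete n) E (complete-expansion n) {{nz}}}
    (λ α → cong (X G α +_) (sym (ℚ.neg-distribˡ-* r (X (complete n) α))))
    (expansion-+· {F = X G} {H = X (complete n)} E (complete-expansion n) (- r)) ,
  positive′
  where
  c = completeCoeff n (1^ n)
  instance
    nz : ℚ.NonZero c
    nz = ℚ.>-nonZero (subst (0ℚ ℚ.<_) (sym (completeCoeff-1^ n)) (fromℕ-pos (#injective-pos n)))
  r = coeff E (1^ n) ÷ c
  cancel-1^ : coeff E (1^ n) + (- r) * c ≡ 0ℚ
  cancel-1^ = begin
    coeff E (1^ n) + (- r) * c ≡⟨ cong (coeff E (1^ n) +_) (sym (ℚ.neg-distribˡ-* r c)) ⟩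
    coeff E (1^ n) - r * c     ≡⟨ cong (λ z → coeff E (1^ n) - z) (÷-* (coeff E (1^ n)) c) ⟩
    coeff E (1^ n) - coeff E (1^ n) ≡⟨ ℚ.+-inverseʳ (coeff E (1^ n)) ⟩
    0ℚ                         ∎
    where open ≡-Reasoning
  keep-other : ∀ {μ} → μ ≢ 1^ n → coeff E μ + (- r) * completeCoeff n μ ≡ coeff E μ
  keep-other {μ} μ≢1^n = trans (cong (λ z → coeff E μ + (- r) * z) (completeCoeff-other μ≢1^n))
    (trans (cong (coeff E μ +_) (ℚ.*-zeroʳ (- r))) (ℚ.+-identityʳ (coeff E μ)))
  by-cases : ∀ {μ} → μ ⊢ n → Dec (μ ≡ 1^ n) → 0ℚ ≤ coeff E μ + (- r) * completeCoeff n μ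
  by-cases _ (yes refl)           = ℚ.≤-reflexive (sym cancel-1^)
  by-cases {μ} μ⊢n (no μ≢1^n) = subst (0ℚ ≤_) (sym (keep-other μ≢1^n)) (positive μ μ⊢n)
  positive′ : ∀ μ → μ ⊢ n → 0ℚ ≤ coeff E μ + (- r) * completeCoeff n μ
  positive′ μ μ⊢n = by-cases μ⊢n (List.≡-dec ℕ._≟_ μ (1^ n))

theorem2p22 : ∀ (n : ℕ) → n ≥ 1 → (G : Graph n) → Connected G → (G ≥ₛ complete n) ⇔ SchurPositive n (X G)
theorem2p22 n _ G _ = mk⇔ (≥ₛ-complete⇒positive G) (positive⇒≥ₛ-complete G)
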